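{- Let $G=(V,E)$ be a cyclically 4-connected cubic non-hamiltonian graph, let $v\in V$ have neighbours $w_1,w_2,w_3$, and let $e=\{x,y\}\in E$ be such that $d(v,x)\ge 3$, $d(v,y)\ge 3$, and for every cyclic edge cut $C$ of $G$ with $|C|=4$, neither $v$ nor $x$ is an endpoint of an edge of $C$ and $v$ and $x$ lie in different components of $G\setminus C$. Let $M$ be a 3-edge-connected cubic multigraph. Then the graph $\mathcal{T}(G,v,e,M)$ is cyclically 5-connected and non-hamiltonian.
   Context: $d(\cdot,\cdot)$ is graph distance. A cyclic edge cut is an edge set whose removal leaves (at least) two components each containing a cycle; a cubic graph is cyclically $k$-connected if it has no cyclic edge cut with fewer than $k$ edges. Construction of $\mathcal{T}(G,v,e,M)$: A brick is a copy of $G$ with the vertex $v$ deleted and the edge $\{x,y\}$ deleted; in a brick the copies of $w_1,w_2,w_3,x,y$ have degree 2. A triple is formed from three bricks $B_1,B_2,B_3$ (with copies $w_{i,1},w_{i,2},w_{i,3},x_i,y_i$ in $B_i$) and three new vertices $z_1,z_2,z_3$, where $z_j$ is joined to $w_{i,j}$ for all $i,j\in\{1,2,3\}$. To form $\mathcal{T}(G,v,e,M)$, replace every vertex $u$ of $M$ by a triple and assign the three bricks of that triple bijectively to the three edges of $M$ incident with $u$. For each edge of $M$, it has two assigned bricks $B$ and $B'$ (from the triples of its two endpoints); add the edges joining the $x$-vertex of $B$ to the $y$-vertex of $B'$ and the $x$-vertex of $B'$ to the $y$-vertex of $B$. The result is cubic. -}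

module Defs where

open import Data.Nat using (ℕ; zero; suc; _<_; _≤_)
open import Data.Fin using (Fin) renaming (_≟_ to _≟ᶠ_)
import Data.Product
open import Data.Product using (Σ; ∃; ∃-syntax; _×_; _,_)
open import Data.Sum using (_⊎_)
open import Data.Empty using (⊥)
open import Data.List using (List; []; _∷_; _++_; length)
open import Data.List.Membership.Propositional using (_∈_)
open import Data.List.Relation.Unary.Unique.Propositional using (Unique)
open import Data.List.Relation.Unary.Linked using (Linked)
open import Data.List.Relation.Unary.AllPairs using (AllPairs)
open import Relation.Nullary using (¬_)
open import Relation.Nullary.Decidable using (False)
open import Relation.Binary.PropositionalEquality using (_≡_; _≢_)

record Graph : Set₁ where
  constructor mkGraph
  field
    V   : Set
    Adj : V → V → Set
open Graph public

module _ (H : Graph) where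

  data Walk : V H → V H → ℕ → Set where
    nil  : ∀ a → Walk a a zero
    cons : ∀ {a b c k} → Adj H a b → Walk b c k → Walk a c (suc k)

  Connected : V H → V H → Set
  Connected a b = ∃[ k ] Walk a b k

  Dist≥ : ℕ → V H → V H → Set
  Dist≥ k a b = ∀ l → l < k → ¬ Walk a b l

  IsCycle : List (V H) → Set
  IsCycle [] = ⊥
  IsCycle (c ∷ rest) = (2 ≤ length rest) × Unique (c ∷ rest) × Linked (Adj H) (c ∷ rest ++ c ∷ [])

  Hamiltonian : Set
  Hamiltonian = ∃[ cs ] (IsCycle cs × (∀ a → a ∈ cs))

  Cubic : Set
  Cubic = ∀ a → Σ (Fin 3 → V H) λ nb → ((∀ (i j : Fin 3) → nb i ≡ nb j → i ≡ j)
                        × (∀ j → Adj H a (nb j))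
                        × (∀ b → Adj H a b → ∃[ j ] (b ≡ nb j)))

  EdgeList : Set
  EdgeList = List (V H × V H)

  IsEdgeList : EdgeList → Set
  IsEdgeList C = ∀ {a b} → (a , b) ∈ C → Adj H a b

  SameEdge : (V H × V H) → (V H × V H) → Set
  SameEdge (a , b) (c , d) = (a ≡ c × b ≡ d) ⊎ (a ≡ d × b ≡ c)

  DistinctEdges : EdgeList → Set
  DistinctEdges C = AllPairs (λ e f → ¬ SameEdge e f) C

  deleteEdges : EdgeList → Graph
  deleteEdges C = mkGraph (V H) (λ a b → Adj H a b × ¬ ((a , b) ∈ C) × ¬ ((b , a) ∈ C))

IsCyclicEdgeCut : (H : Graph) → EdgeList H → Set
IsCyclicEdgeCut H C =
  IsEdgeList H C ×
  ∃[ Z₁ ] ∃[ Z₂ ] (IsCycle (deleteEdges H C) Z₁ × IsCycle (deleteEdges H C) Z₂ ×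
    ∃[ a ] ∃[ b ] (a ∈ Z₁ × b ∈ Z₂ × ¬ Connected (deleteEdges H C) a b))

CyclicallyConnected : ℕ → Graph → Set
CyclicallyConnected k H = ∀ (C : EdgeList H) → length C < k → ¬ IsCyclicEdgeCut H C

-- Cubic multigraphs, as darts: vertex u has the three darts (u , i),
-- i : Fin 3, and σ pairs the darts into edges (fixed-point-free involution).

Dart : ℕ → Set
Dart m = Fin m × Fin 3

record CubicMultigraph (m : ℕ) : Set where
  field
    σ      : Dart m → Dart m
    invol  : ∀ d → σ (σ d) ≡ d
    noFix  : ∀ d → σ d ≢ d
open CubicMultigraph public

module _ {m : ℕ} (M : CubicMultigraph m) where

  data MConn (avoid : Dart m → Set) : Fin m → Fin m → Set where
    here : ∀ u → MConn avoid u u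
    step : ∀ {t} u i → ¬ avoid (u , i) →
           MConn avoid (Data.Product.proj₁ (σ M (u , i))) t → MConn avoid u t

  -- removing any set of at most 2 edges (given by a list of darts, each
  -- dart d standing for the edge {d , σ d}) leaves M connected
  ThreeEdgeConnected : Set
  ThreeEdgeConnected = ∀ (F : List (Dart m)) → length F ≤ 2 → ∀ u u' →
    MConn (λ d → d ∈ F ⊎ σ M d ∈ F) u u'

-- The construction T(G, v, e, M), G on vertex set Fin n with adjacency E,
-- w = (w₁,w₂,w₃) the neighbours of v, e = {x , y}.

module Construction {n : ℕ} (E : Fin n → Fin n → Set) (v : Fin n)
                    (w : Fin 3 → Fin n) (x y : Fin n)
                    {m : ℕ} (M : CubicMultigraph m) where

  -- brk u i a : copy of vertex a (≠ v) in brick i of the triple of u;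
  -- zv u j : the vertex z_j of the triple of u
  data TV : Set where
    brk : Fin m → Fin 3 → (a : Fin n) → False (a ≟ᶠ v) → TV
    zv  : Fin m → Fin 3 → TV

  data TAdj : TV → TV → Set where
    inBrick : ∀ {u i a b p q} → E a b → ¬ ((a ≡ x × b ≡ y) ⊎ (a ≡ y × b ≡ x)) →
              TAdj (brk u i a p) (brk u i b q)
    wz      : ∀ {u i j p} → TAdj (brk u i (w j) p) (zv u j)
    zw      : ∀ {u i j p} → TAdj (zv u j) (brk u i (w j) p)
    linkxy  : ∀ {u i u' i' p q} → σ M (u , i) ≡ (u' , i') →
              TAdj (brk u i x p) (brk u' i' y q)
    linkyx  : ∀ {u i u' i' p q} → σ M (u , i) ≡ (u' , i') →
              TAdj (brk u i y p) (brk u' i' x q)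

  T : Graph
  T = mkGraph TV TAdj

module Submission where

-- Cyclic connectivity.  View a cut of T with at most four edges as a 2-colouring of the vertices.
-- The hypotheses on G imply that a nonempty part of a brick holding at most two of its five
-- terminals has at least two boundary edges inside the brick, so recolouring each brick by the
-- majority of its terminals does not increase the cut.  As M is 3-edge-connected, all bricks then
-- receive the same colour, as do all z-vertices but at most one.  Counting again in the original
-- colouring, the other colour class has at most two vertices and so contains no cycle; the 4-cut
-- hypothesis is needed when this class lies within a single brick.
--
-- Hamiltonicity.  On a Hamiltonian cycle of T the z-vertices of a triple have six edges, so
-- some brick of the triple receives an even number of them.  As G is not Hamiltonian, the cycle contains a
-- segment joining x to y inside that brick.  The partner brick then has such a segment too, and the
-- two segments close up to a cycle that misses the z-vertices.

open import Defs
open import Data.Nat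
open import Data.Nat.Properties
open import Data.Nat.ListAction using (sum)
open import Data.Nat.ListAction.Properties using (sum-++; sum-↭)
open import Data.Nat.Tactic.RingSolver using (solve-∀)
open import Data.Bool using (Bool; true; false; not; _∧_; if_then_else_; _xor_)
import Data.Bool as Bool
import Data.Bool.Properties as Bool
open import Data.Empty using (⊥; ⊥-elim)
open import Data.Unit using (tt)
open import Data.Fin using (Fin; zero; suc)
import Data.Fin as Fin
import Data.Fin.Properties as Fin
open import Data.Maybe using (Maybe; just; nothing)
import Data.Maybe.Properties as Maybe
open import Data.Product using (Σ; ∃-syntax; _×_; _,_; proj₁; proj₂; swap)
open import Data.Product.Properties using (≡-dec)
open import Data.Sum using (_⊎_; inj₁; inj₂; [_,_]′)
import Data.Sum as Sum
open import Data.Vec as Vec using (Vec)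
open import Data.List hiding (sum)
open import Data.List.Properties using (length-map; length-++; length-tabulate; length-filter; length-deduplicate; map-++; map-∘; ++-assoc; ++-identityʳ; unfold-reverse; reverse-++; ∷-injective; ∷-injectiveˡ)
open import Data.List.Membership.Propositional using (_∈_)
open import Data.List.Membership.Propositional.Properties
import Data.List.Membership.DecPropositional as DecMembership
open import Data.List.Relation.Unary.Any using (here; there)
open import Data.List.Relation.Unary.All as All using (All; []; _∷_)
import Data.List.Relation.Unary.All.Properties as All
open import Data.List.Relation.Unary.AllPairs using ([]; _∷_)
open import Data.List.Relation.Unary.Unique.Propositional using (Unique)
import Data.List.Relation.Unary.Unique.Propositional.Properties as Unique
import Data.List.Relation.Unary.Unique.DecPropositional.Properties as UniqueDec
open import Data.List.Relation.Unary.Linked as Linked using (Linked; []; [-]; _∷_)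
open import Data.List.Relation.Binary.Permutation.Propositional using (_↭_; ↭-sym; ↭-refl; ↭-trans; ↭⇒↭ₛ)
open import Data.List.Relation.Binary.Permutation.Propositional.Properties using (shift; ∈-resp-↭; map⁺; ↭-length; ++-comm; ++⁺; ↭-reverse)
import Data.List.Relation.Binary.Permutation.Setoid.Properties as PermutationSetoid
open import Relation.Nullary
open import Relation.Nullary.Decidable using (False; fromWitnessFalse; toWitnessFalse; map′; _×-dec_; _⊎-dec_; decidable-stable)
open import Relation.Unary using (Decidable)
open import Relation.Binary.PropositionalEquality hiding ([_])
open import Function using (_∘_; id)

-- Cycles come from one count: an acyclic set of k ≥ 1 vertices of a cubic graph sends out at least
-- k + 2 edges. So a side of a cut with k vertices and at most k + 1 boundary edges contains a
-- cycle, and exhibiting a few vertices on each side is enough to contradict cyclic connectivity.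
-- The hypotheses concern cuts of G, whereas a cut of T shows only its part inside a brick. Passing
-- back to G restores one edge per terminal of the cut-off part; this is why terminals are counted,
-- and why parts with at most two of the five are under control. A triple with its bricks contracted
-- is K₃,₃, so a brick differing from the other two costs three cut edges. This reserve lets the
-- colouring be handed on to M, where each cut edge is seen from both ends and a bound of four
-- leaves two. On the Hamiltonian side, segments covering a brick either include one from x to y or
-- use an odd number of edges to z-vertices: a single segment between two w's closes through v, and
-- two segments from w's to x and to y close through v and the edge xy.

module _ {A : Set} where

  -- Lists without repetition and linked lists

  Unique-↭ : ∀ {xs ys : List A} → xs ↭ ys → Unique xs → Unique ys
  Unique-↭ p = PermutationSetoid.Unique-resp-↭ (setoid A) (↭⇒↭ₛ p)

  unique-++ˡ : ∀ (xs : List A) {ys} → Unique (xs ++ ys) → Unique xs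
  unique-++ˡ [] u = []
  unique-++ˡ (x ∷ xs) (p ∷ u) = All.++⁻ˡ xs p ∷ unique-++ˡ xs u

  unique-++ʳ : ∀ (xs : List A) {ys} → Unique (xs ++ ys) → Unique ys
  unique-++ʳ [] u = u
  unique-++ʳ (x ∷ xs) (p ∷ u) = unique-++ʳ xs u

  unique-disjoint : ∀ (xs : List A) {ys} → Unique (xs ++ ys) → ∀ {a} → a ∈ xs → a ∈ ys → ⊥
  unique-disjoint (x ∷ xs) (p ∷ u) (here refl) q = All.lookup p (∈-++⁺ʳ xs q) refl
  unique-disjoint (x ∷ xs) (p ∷ u) (there r) q = unique-disjoint xs u r q

  unique-∷ : ∀ {a : A} {xs} → ¬ (a ∈ xs) → Unique xs → Unique (a ∷ xs)
  unique-∷ {a} {xs} a∉ u = All.tabulate (λ { i refl → a∉ i }) ∷ u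

  unique-⊆-remove : ∀ {x : A} {xs ys} → Unique (x ∷ xs) → (∀ {a} → a ∈ x ∷ xs → a ∈ ys) →
    ∃[ zs ] (ys ↭ x ∷ zs × (∀ {a} → a ∈ xs → a ∈ zs))
  unique-⊆-remove {x} {xs} {ys} u s with ∈-∃++ (s (here refl))
  ... | pre , post , refl = pre ++ post , shift x pre post , sub
    where
    sub : ∀ {a} → a ∈ xs → a ∈ pre ++ post
    sub i with ∈-resp-↭ (shift x pre post) (s (there i))
    ... | here refl = ⊥-elim (Unique.Unique[x∷xs]⇒x∉xs u i)
    ... | there j = j

  unique-⊆-length : ∀ {xs ys : List A} → Unique xs → (∀ {a} → a ∈ xs → a ∈ ys) → length xs ≤ length ys
  unique-⊆-length {[]} u s = z≤n
  unique-⊆-length {x ∷ xs} u@(_ ∷ u′) s with unique-⊆-remove u s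
  ... | zs , perm , sub = subst (suc (length xs) ≤_) (sym (↭-length perm)) (s≤s (unique-⊆-length u′ sub))

  length-filter-partition : ∀ {P : A → Set} (P? : Decidable P) xs →
    length (filter P? xs) + length (filter (¬? ∘ P?) xs) ≡ length xs
  length-filter-partition P? [] = refl
  length-filter-partition P? (x ∷ xs) with P? x
  ... | yes _ = cong suc (length-filter-partition P? xs)
  ... | no _ = trans (+-suc _ _) (cong suc (length-filter-partition P? xs))

  length-filter-avoiding : ∀ {P : A → Set} (P? : Decidable P) {xs ys} → Unique ys →
    (∀ {a} → a ∈ ys → a ∈ xs × ¬ P a) → length (filter P? xs) + length ys ≤ length xs
  length-filter-avoiding P? {xs} {ys} u s = subst (length (filter P? xs) + length ys ≤_)
    (length-filter-partition P? xs)
    (+-monoʳ-≤ (length (filter P? xs))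
      (unique-⊆-length u (λ i → ∈-filter⁺ (¬? ∘ P?) (proj₁ (s i)) (proj₂ (s i)))))

  module _ {R : A → A → Set} where

    linked-++ˡ : ∀ xs {t : A} {ys} → Linked R (xs ++ t ∷ ys) → Linked R (xs ++ t ∷ [])
    linked-++ˡ [] l = [-]
    linked-++ˡ (x ∷ []) (r ∷ l) = r ∷ [-]
    linked-++ˡ (x ∷ y ∷ xs) (r ∷ l) = r ∷ linked-++ˡ (y ∷ xs) l

    linked-++ʳ : ∀ xs {ys : List A} → Linked R (xs ++ ys) → Linked R ys
    linked-++ʳ [] l = l
    linked-++ʳ (x ∷ []) {[]} l = []
    linked-++ʳ (x ∷ []) {_ ∷ _} (r ∷ l) = l
    linked-++ʳ (x ∷ y ∷ xs) (r ∷ l) = linked-++ʳ (y ∷ xs) l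

    linked-join : ∀ xs {t : A} {ys} → Linked R (xs ++ t ∷ []) → Linked R (t ∷ ys) → Linked R (xs ++ t ∷ ys)
    linked-join [] l k = k
    linked-join (x ∷ []) (r ∷ l) k = r ∷ k
    linked-join (x ∷ y ∷ xs) (r ∷ l) k = r ∷ linked-join (y ∷ xs) l k

  linked-map-All : ∀ {R R′ : A → A → Set} {P : A → Set} → (∀ {a b} → P a → P b → R a b → R′ a b) →
    ∀ {xs} → All P xs → Linked R xs → Linked R′ xs
  linked-map-All f [] [] = []
  linked-map-All f (p ∷ []) [-] = [-]
  linked-map-All f (p ∷ q ∷ ps) (r ∷ l) = f p q r ∷ linked-map-All f (q ∷ ps) l

  linked-invariant : ∀ {B : Set} {R : A → A → Set} (f : A → B) → (∀ {a b} → R a b → f a ≡ f b) →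
    ∀ {x xs} → Linked R (x ∷ xs) → ∀ {a} → a ∈ x ∷ xs → f a ≡ f x
  linked-invariant f h l (here refl) = refl
  linked-invariant f h (r ∷ l) (there i) = trans (linked-invariant f h l i) (sym (h r))

unique-length-Fin : ∀ {n} {xs : List (Fin n)} → Unique xs → length xs ≤ n
unique-length-Fin {n} {xs} u = subst (length xs ≤_) (length-tabulate id) (unique-⊆-length u (λ _ → ∈-allFin _))

-- No hypothesis decides reachability. Since the goals are negations, this exchange of a finite
-- quantifier with double negation allows reachability to be treated as decided at all vertices at
-- once.
¬¬-∀Fin : ∀ {n} {P : Fin n → Set} → (∀ i → ¬ ¬ P i) → ¬ ¬ (∀ i → P i)
¬¬-∀Fin {zero} h k = k (λ ())
¬¬-∀Fin {suc n} {P} h k = h Fin.zero λ p → ¬¬-∀Fin {n} (h ∘ Fin.suc) λ q → k λ { Fin.zero → p ; (Fin.suc i) → q i }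

-- Cuts of a cubic graph

Sub : ℕ → Set
Sub n = Fin n → Bool

true≢false : ∀ {b} → b ≡ true → b ≡ false → ⊥
true≢false refl ()

module _ {n : ℕ} where

  _⊆ₗ_ : List (Fin n) → Sub n → Set
  U ⊆ₗ S = ∀ {a} → a ∈ U → S a ≡ true

  _∖_ : Sub n → Fin n → Sub n
  (S ∖ s) a with a Fin.≟ s
  ... | yes _ = false
  ... | no _ = S a

  ∖-true : ∀ S s {a} → a ≢ s → S a ≡ true → (S ∖ s) a ≡ true
  ∖-true S s {a} ne p with a Fin.≟ s
  ... | yes e = ⊥-elim (ne e)
  ... | no _ = p

  ∖-true⁻ : ∀ S s {a} → (S ∖ s) a ≡ true → a ≢ s × S a ≡ true
  ∖-true⁻ S s {a} p with a Fin.≟ s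
  ... | no ne = ne , p

  ∖-false⁻ : ∀ S s {a} → a ≢ s → (S ∖ s) a ≡ false → S a ≡ false
  ∖-false⁻ S s {a} ne p with a Fin.≟ s
  ... | yes e = ⊥-elim (ne e)
  ... | no _ = p

maj3 : Bool → Bool → Bool → Bool
maj3 true true _ = true
maj3 true false c = c
maj3 false true c = c
maj3 false false _ = false

-- A majority vote with its witnesses: two indices that vote `b`, and the remaining one, whose vote
-- is left open.
record Split3 (f : Fin 3 → Bool) (b : Bool) : Set where
  constructor split3
  field
    j j′ j″ : Fin 3
    j≢j′ : j ≢ j′
    fj : f j ≡ b
    fj′ : f j′ ≡ b
    cover : ∀ k → k ≡ j ⊎ k ≡ j′ ⊎ k ≡ j″

maj3-split : ∀ (f : Fin 3 → Bool) b → maj3 (f zero) (f (suc zero)) (f (suc (suc zero))) ≡ b → Split3 f b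
maj3-split f b eq with f zero in e0 | f (suc zero) in e1 | f (suc (suc zero)) in e2
maj3-split f true eq | true | true | _ = split3 zero (suc zero) (suc (suc zero)) (λ ()) e0 e1
  λ { zero → inj₁ refl ; (suc zero) → inj₂ (inj₁ refl) ; (suc (suc zero)) → inj₂ (inj₂ refl) }
maj3-split f true eq | true | false | true = split3 zero (suc (suc zero)) (suc zero) (λ ()) e0 e2
  λ { zero → inj₁ refl ; (suc zero) → inj₂ (inj₂ refl) ; (suc (suc zero)) → inj₂ (inj₁ refl) }
maj3-split f false eq | true | false | false = split3 (suc zero) (suc (suc zero)) zero (λ ()) e1 e2
  λ { zero → inj₂ (inj₂ refl) ; (suc zero) → inj₁ refl ; (suc (suc zero)) → inj₂ (inj₁ refl) }
maj3-split f true eq | false | true | true = split3 (suc zero) (suc (suc zero)) zero (λ ()) e1 e2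
  λ { zero → inj₂ (inj₂ refl) ; (suc zero) → inj₁ refl ; (suc (suc zero)) → inj₂ (inj₁ refl) }
maj3-split f false eq | false | true | false = split3 zero (suc (suc zero)) (suc zero) (λ ()) e0 e2
  λ { zero → inj₁ refl ; (suc zero) → inj₂ (inj₂ refl) ; (suc (suc zero)) → inj₂ (inj₁ refl) }
maj3-split f false eq | false | false | _ = split3 zero (suc zero) (suc (suc zero)) (λ ()) e0 e1
  λ { zero → inj₁ refl ; (suc zero) → inj₂ (inj₁ refl) ; (suc (suc zero)) → inj₂ (inj₂ refl) }

walk-snoc : ∀ {H : Graph} {a b c k} → Walk H a b k → Adj H b c → Connected H a c
walk-snoc (nil _) e = 1 , cons e (nil _)
walk-snoc (cons f wk) e with walk-snoc wk e
... | k , wk′ = suc k , cons f wk′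

module CubicGraph {n : ℕ} (E : Fin n → Fin n → Set) (sym-E : ∀ a b → E a b → E b a)
                  (irrefl-E : ∀ a → ¬ E a a) (cubic : Cubic (mkGraph (Fin n) E)) where

  G : Graph
  G = mkGraph (Fin n) E

  nb : Fin n → Fin 3 → Fin n
  nb a = proj₁ (cubic a)

  nb-inj : ∀ a {i j} → nb a i ≡ nb a j → i ≡ j
  nb-inj a {i} {j} = proj₁ (proj₂ (cubic a)) i j

  nb-adj : ∀ a j → E a (nb a j)
  nb-adj a = proj₁ (proj₂ (proj₂ (cubic a)))

  nb-all : ∀ {a b} → E a b → ∃[ j ] b ≡ nb a j
  nb-all {a} {b} = proj₂ (proj₂ (proj₂ (cubic a))) b

  _≟ₑ_ : (p q : Fin n × Fin n) → Dec (p ≡ q)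
  _≟ₑ_ = ≡-dec Fin._≟_ Fin._≟_

  open DecMembership _≟ₑ_ public using () renaming (_∈?_ to _∈ₑ?_)
  open DecMembership (Fin._≟_ {n}) using (_∈?_)

  E? : ∀ a b → Dec (E a b)
  E? a b with Fin.any? (λ j → b Fin.≟ nb a j)
  ... | yes (j , refl) = yes (nb-adj a j)
  ... | no h = no (h ∘ nb-all)

  -- Pairs are directed out of `S`, and `L` may hold others besides, so its length only bounds the
  -- boundary from above.
  Cover : Sub n → List (Fin n × Fin n) → Set
  Cover S L = ∀ a b → S a ≡ true → S b ≡ false → E a b → (a , b) ∈ L

  CycleIn : Sub n → Set
  CycleIn S = ∃[ Z ] (IsCycle G Z × (Z ⊆ₗ S))

  -- A path h ∷ s ∷ rest inside S is prolonged at h by a neighbour other than s,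
  -- until that neighbour lies on the path.
  grow : ∀ S → (∀ h s → S h ≡ true → ∃[ t ] (S t ≡ true × E h t × t ≢ s)) →
    ∀ fuel h s rest → Unique (h ∷ s ∷ rest) → Linked E (h ∷ s ∷ rest) → (h ∷ s ∷ rest) ⊆ₗ S →
    n < fuel + length (h ∷ s ∷ rest) → CycleIn S
  grow S forward zero h s rest u l a lt = ⊥-elim (<⇒≱ lt (unique-length-Fin u))
  grow S forward (suc fuel) h s rest u l a lt with forward h s (a (here refl))
  ... | t , St , ht , t≢s with t ∈? (h ∷ s ∷ rest)
  ...   | no t∉ = grow S forward fuel t h (s ∷ rest) (unique-∷ t∉ u) (sym-E h t ht ∷ l)
                    (λ { (here refl) → St ; (there i) → a i })
                    (subst (n <_) (sym (+-suc fuel _)) lt)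
  ...   | yes (here refl) = ⊥-elim (irrefl-E _ ht)
  ...   | yes (there (here refl)) = ⊥-elim (t≢s refl)
  ...   | yes (there (there i)) with ∈-∃++ i
  ...     | pre , post , refl = (t ∷ h ∷ s ∷ pre)
            , (s≤s (s≤s z≤n)
              , unique-++ˡ (t ∷ h ∷ s ∷ pre) (Unique-↭ (shift t (h ∷ s ∷ pre) post) u)
              , (sym-E h t ht ∷ linked-++ˡ (h ∷ s ∷ pre) l))
            , λ { (here refl) → St ; (there i) → a (∈-++⁺ˡ i) }

  minDegree2⇒cycle : ∀ S s → S s ≡ true → (∀ a → S a ≡ true → Split3 (S ∘ nb a) true) → CycleIn S
  minDegree2⇒cycle S s Ss h with h s Ss
  ... | split3 j _ _ _ Sj _ _ = grow S forward n (nb s j) s []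
          (unique-∷ (λ { (here e) → irrefl-E s (subst (E s) e (nb-adj s j)) }) ([] ∷ []))
          (sym-E _ _ (nb-adj s j) ∷ [-]) (λ { (here refl) → Sj ; (there (here refl)) → Ss })
          (m<m+n n (s≤s z≤n))
    where
    forward : ∀ h′ s′ → S h′ ≡ true → ∃[ t ] (S t ≡ true × E h′ t × t ≢ s′)
    forward h′ s′ Sh with h h′ Sh
    ... | split3 i i′ _ ne p q _ with nb h′ i Fin.≟ s′
    ...   | no e = nb h′ i , p , nb-adj h′ i , e
    ...   | yes refl = nb h′ i′ , q , nb-adj h′ i′ , ne ∘ sym ∘ nb-inj h′

  degᵇ : Sub n → Fin n → Bool
  degᵇ S a = maj3 (S (nb a zero)) (S (nb a (suc zero))) (S (nb a (suc (suc zero))))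

  -- While |L| ≤ |U| + 1, a vertex with at most one neighbour in S can be removed from S:
  -- the boundary shrinks by at least one.
  cycleIn : ∀ k S L U → Cover S L → length L ≤ k → Unique U → U ⊆ₗ S → 1 ≤ length U →
    length L ≤ suc (length U) → CycleIn S
  cycleIn k S L U@(u₀ ∷ _) cov Lk uU U⊆S pos LU
    with Fin.any? (λ a → (S a Bool.≟ true) ×-dec (degᵇ S a Bool.≟ false))
  ... | no none = minDegree2⇒cycle S u₀ (U⊆S (here refl)) λ a Sa → maj3-split (S ∘ nb a) true (maj a Sa)
    where
    maj : ∀ a → S a ≡ true → degᵇ S a ≡ true
    maj a Sa with degᵇ S a in e
    ... | true = refl
    ... | false = ⊥-elim (none (a , Sa , e))
  ... | yes (s , Ss , ms) with maj3-split (S ∘ nb s) false ms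
  ...   | split3 j j′ j″ j≢j′ Sj Sj′ cover3 = go k Lk
    where
    s? : Decidable (λ (e : Fin n × Fin n) → proj₁ e ≢ s)
    s? e = ¬? (proj₁ e Fin.≟ s)
    -- At least two edges leave `S` at `s` and are dropped; the one edge by which `s` may still be
    -- attached to the rest becomes a boundary edge.
    L′ = (nb s j″ , s) ∷ filter s? L
    out : ∀ i → S (nb s i) ≡ false → (s , nb s i) ∈ L
    out i e = cov s (nb s i) Ss e (nb-adj s i)
    two : length (filter s? L) + 2 ≤ length L
    two = length-filter-avoiding s? {L} {(s , nb s j) ∷ (s , nb s j′) ∷ []}
      (((λ e → j≢j′ (nb-inj s (cong proj₂ e))) ∷ []) ∷ [] ∷ [])
      (λ { (here refl) → out j Sj , λ f → f refl ; (there (here refl)) → out j′ Sj′ , λ f → f refl })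
    L′<L : length L′ < length L
    L′<L = subst (_≤ length L) (+-comm (length (filter s? L)) 2) two
    cov′ : Cover (S ∖ s) L′
    cov′ a b Sa Sb ab with ∖-true⁻ S s Sa | b Fin.≟ s
    ... | a≢s , Sa′ | no ne = there (∈-filter⁺ s? (cov a b Sa′ (∖-false⁻ S s ne Sb) ab) a≢s)
    ... | a≢s , Sa′ | yes refl with nb-all (sym-E _ _ ab)
    ...   | i , refl with cover3 i
    ...     | inj₁ refl = ⊥-elim (true≢false Sa′ Sj)
    ...     | inj₂ (inj₁ refl) = ⊥-elim (true≢false Sa′ Sj′)
    ...     | inj₂ (inj₂ refl) = here refl
    u? : Decidable (λ a → a ≢ s)
    u? a = ¬? (a Fin.≟ s)
    U′ = filter u? U
    U≤ : length U ≤ suc (length U′)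
    U≤ = unique-⊆-length {xs = U} {ys = s ∷ U′} uU sub
      where
      sub : ∀ {a} → a ∈ U → a ∈ s ∷ U′
      sub {a} i with a Fin.≟ s
      ... | yes e = here e
      ... | no ne = there (∈-filter⁺ u? i ne)
    U′⊆ : U′ ⊆ₗ (S ∖ s)
    U′⊆ i with ∈-filter⁻ u? {xs = U} i
    ... | q , ne = ∖-true S s ne (U⊆S q)
    go : ∀ k → length L ≤ k → CycleIn S
    back : CycleIn (S ∖ s) → CycleIn S
    back (Z , c , h) = Z , c , λ i → proj₂ (∖-true⁻ S s (h i))
    go zero Lk = ⊥-elim (<⇒≱ L′<L (≤-trans Lk z≤n))
    go (suc k) Lk with 1 ≤? length U′
    ... | yes p = back (cycleIn k (S ∖ s) L′ U′ cov′ (≤-pred (≤-trans L′<L Lk)) (Unique.filter⁺ u? uU) U′⊆ p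
                    (≤-trans (≤-pred (≤-trans L′<L LU)) (≤-trans U≤ ≤-refl)))
    -- Now `U` consists of `s` alone and `L` has at most two entries. The third neighbour is the new
    -- witness if it lies in `S`; otherwise three boundary edges contradict the bound.
    ... | no np with S (nb s j″) in e″
    ...   | true = back (cycleIn k (S ∖ s) L′ (nb s j″ ∷ []) cov′ (≤-pred (≤-trans L′<L Lk)) ([] ∷ [])
                    (λ { (here refl) → ∖-true S s (λ e → irrefl-E s (subst (E s) e (nb-adj s j″))) e″ }) (s≤s z≤n)
                    (≤-trans (≤-pred (≤-trans L′<L LU)) (≤-trans U≤ (s≤s (≤-pred (≤-trans (≰⇒> np) (s≤s z≤n)))))))
    ...   | false = ⊥-elim (<⇒≱ {2} {3} ≤-refl
        (≤-trans (unique-⊆-length {xs = map (λ i → s , nb s i) (allFin 3)} {ys = L}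
          (Unique.map⁺ {f = λ i → s , nb s i} (λ {i} {l} e → nb-inj s {i} {l} (cong proj₂ e)) (Unique.allFin⁺ 3)) three)
          (≤-trans LU (s≤s (≤-trans U≤ (s≤s (≤-pred (≰⇒> np))))))))
      where
      three : ∀ {a} → a ∈ map (λ i → s , nb s i) (allFin 3) → a ∈ L
      three i with ∈-map⁻ (λ i → s , nb s i) i
      ... | i , _ , refl with cover3 i
      ...   | inj₁ refl = out i Sj
      ...   | inj₂ (inj₁ refl) = out i Sj′
      ...   | inj₂ (inj₂ refl) = out i e″

  IsBoundary : Sub n → List (Fin n × Fin n) → Set
  IsBoundary S C = ∀ {a b} → (a , b) ∈ C → S a ≡ true × S b ≡ false × E a b

  boundary? : ∀ (S : Sub n) → Decidable (λ (e : Fin n × Fin n) → S (proj₁ e) ≡ true × S (proj₂ e) ≡ false × E (proj₁ e) (proj₂ e))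
  boundary? S (a , b) = (S a Bool.≟ true) ×-dec ((S b Bool.≟ false) ×-dec E? a b)

  -- A `Cover` may contain non-edges and repetitions, while the hypotheses on cuts of G ask for
  -- edges, and for pairwise distinct ones.
  boundary : Sub n → List (Fin n × Fin n) → List (Fin n × Fin n)
  boundary S L = deduplicate _≟ₑ_ (filter (boundary? S) L)

  boundary-length : ∀ (S : Sub n) L → length (boundary S L) ≤ length L
  boundary-length S L = ≤-trans (length-deduplicate _≟ₑ_ (filter (boundary? S) L)) (length-filter (boundary? S) L)

  boundary-isBoundary : ∀ (S : Sub n) L → IsBoundary S (boundary S L)
  boundary-isBoundary S L i = proj₂ (∈-filter⁻ (boundary? S) {xs = L} (∈-deduplicate⁻ _≟ₑ_ (filter (boundary? S) L) i))

  boundary-cover : ∀ (S : Sub n) L → Cover S L → Cover S (boundary S L)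
  boundary-cover S L cov a b Sa Sb ab =
    ∈-deduplicate⁺ _≟ₑ_ (∈-filter⁺ (boundary? S) (cov a b Sa Sb ab) (Sa , Sb , ab))

  -- All entries point out of `S`, so none is the reverse of another and absence of repetitions is
  -- enough.
  boundary-distinct : ∀ (S : Sub n) L → DistinctEdges G (boundary S L)
  boundary-distinct S L = go (boundary-isBoundary S L) (UniqueDec.deduplicate-! _≟ₑ_ (filter (boundary? S) L))
    where
    go : ∀ {C} → IsBoundary S C → Unique C → DistinctEdges G C
    go {[]} h u = []
    go {(a , b) ∷ C} h (p ∷ u) = All.tabulate different ∷ go (h ∘ there) u
      where
      different : ∀ {e} → e ∈ C → ¬ SameEdge G (a , b) e
      different i (inj₁ (refl , refl)) = All.lookup p i refl
      different i (inj₂ (refl , refl)) = true≢false (proj₁ (h (here refl))) (proj₁ (proj₂ (h (there i))))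

  compl : Sub n → Sub n
  compl S a = not (S a)

  not-true⁻ : ∀ {b} → not b ≡ true → b ≡ false
  not-true⁻ {false} _ = refl

  not-false⁻ : ∀ {b} → not b ≡ false → b ≡ true
  not-false⁻ {true} _ = refl

  compl-cover : ∀ {S L} → Cover S L → Cover (compl S) (map swap L)
  compl-cover cov a b Sa Sb ab = ∈-map⁺ swap (cov b a (not-false⁻ Sb) (not-true⁻ Sa) (sym-E a b ab))

  walk-side : ∀ {S C} → Cover S C → ∀ {a b k} → Walk (deleteEdges G C) a b k → S a ≡ S b
  walk-side cov (nil a) = refl
  walk-side {S} cov {a} (cons {b = b} (ab , ∉ , ∉ˢ) wk) with S a in p | S b in q
  ... | true | true = trans (sym q) (walk-side cov wk)
  ... | false | false = trans (sym q) (walk-side cov wk)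
  ... | true | false = ⊥-elim (∉ (cov _ _ p q ab))
  ... | false | true = ⊥-elim (∉ˢ (cov _ _ q p (sym-E _ _ ab)))

  cycle-survives : ∀ {S C Z} b → (∀ {a} → a ∈ Z → S a ≡ b) → IsBoundary S C → IsCycle G Z → IsCycle (deleteEdges G C) Z
  cycle-survives {S} {C} {c ∷ rest} b h bd (len , u , l) = len , u , linked-map-All keep (All.tabulate h′) l
    where
    h′ : ∀ {a} → a ∈ c ∷ rest ++ c ∷ [] → S a ≡ b
    h′ i with ∈-++⁻ (c ∷ rest) i
    ... | inj₁ j = h j
    ... | inj₂ (here refl) = h (here refl)
    keep : ∀ {a d} → S a ≡ b → S d ≡ b → E a d → Adj (deleteEdges G C) a d
    keep p q ad = ad , (λ i → true≢false (trans q (trans (sym p) (proj₁ (bd i)))) (proj₁ (proj₂ (bd i))))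
                     , (λ i → true≢false (trans p (trans (sym q) (proj₁ (bd i)))) (proj₁ (proj₂ (bd i))))

  boundary-cyclicCut : ∀ (S : Sub n) L → Cover S L → CycleIn S → CycleIn (compl S) → IsCyclicEdgeCut G (boundary S L)
  boundary-cyclicCut S L cov (Z₁@(a ∷ _) , c₁ , h₁) (Z₂@(b ∷ _) , c₂ , h₂) =
    (λ i → proj₂ (proj₂ (bd i)))
    , Z₁ , Z₂ , cycle-survives true h₁ bd c₁ , cycle-survives false (not-true⁻ ∘ h₂) bd c₂
    , a , b , here refl , here refl
    , λ { (_ , wk) → true≢false (h₁ (here refl)) (trans (walk-side (boundary-cover S L cov) wk) (not-true⁻ (h₂ (here refl)))) }
    where bd = boundary-isBoundary S L

  module _ (cyc4 : CyclicallyConnected 4 G) where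

    -- Sizes of both sides are witnessed by the duplicate-free lists U and W.
    no-small-cut : ∀ S L U W → Cover S L → length L ≤ 3 →
      Unique U → U ⊆ₗ S → 1 ≤ length U → length L ≤ suc (length U) →
      Unique W → W ⊆ₗ compl S → 1 ≤ length W → length L ≤ suc (length W) → ⊥
    no-small-cut S L U W cov L3 uU US pU LU uW WS pW LW =
      cyc4 (boundary S L) (s≤s (≤-trans (boundary-length S L) L3))
        (boundary-cyclicCut S L cov (cycleIn (length L) S L U cov ≤-refl uU US pU LU)
          (cycleIn (length L) (compl S) (map swap L) W (compl-cover {S} cov) (≤-reflexive (length-map swap L))
            uW WS pW (subst (_≤ suc (length W)) (sym (length-map swap L)) LW)))

-- Cuts of a brick

data Term : Set where
  W   : Fin 3 → Term
  X Y : Term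

W-injective : ∀ {i j} → W i ≡ W j → i ≡ j
W-injective refl = refl

terms : List Term
terms = X ∷ Y ∷ map W (allFin 3)

∈-terms : ∀ τ → τ ∈ terms
∈-terms X = here refl
∈-terms Y = there (here refl)
∈-terms (W j) = there (there (∈-map⁺ W (∈-allFin j)))

terms-unique : Unique terms
terms-unique = ((λ ()) ∷ (λ ()) ∷ (λ ()) ∷ (λ ()) ∷ []) ∷ ((λ ()) ∷ (λ ()) ∷ (λ ()) ∷ []) ∷
  Unique.map⁺ W-injective (Unique.allFin⁺ 3)

third : (j j′ : Fin 3) → j ≢ j′ → ∃[ l ] (∀ i → i ≡ j ⊎ i ≡ j′ ⊎ i ≡ l)
third zero zero ne = ⊥-elim (ne refl)
third zero (suc zero) ne = suc (suc zero) , λ { zero → inj₁ refl ; (suc zero) → inj₂ (inj₁ refl) ; (suc (suc zero)) → inj₂ (inj₂ refl) }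
third zero (suc (suc zero)) ne = suc zero , λ { zero → inj₁ refl ; (suc zero) → inj₂ (inj₂ refl) ; (suc (suc zero)) → inj₂ (inj₁ refl) }
third (suc zero) zero ne = suc (suc zero) , λ { zero → inj₂ (inj₁ refl) ; (suc zero) → inj₁ refl ; (suc (suc zero)) → inj₂ (inj₂ refl) }
third (suc zero) (suc zero) ne = ⊥-elim (ne refl)
third (suc zero) (suc (suc zero)) ne = zero , λ { zero → inj₂ (inj₂ refl) ; (suc zero) → inj₁ refl ; (suc (suc zero)) → inj₂ (inj₁ refl) }
third (suc (suc zero)) zero ne = suc zero , λ { zero → inj₂ (inj₁ refl) ; (suc zero) → inj₂ (inj₂ refl) ; (suc (suc zero)) → inj₁ refl }
third (suc (suc zero)) (suc zero) ne = zero , λ { zero → inj₂ (inj₂ refl) ; (suc zero) → inj₂ (inj₁ refl) ; (suc (suc zero)) → inj₁ refl }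
third (suc (suc zero)) (suc (suc zero)) ne = ⊥-elim (ne refl)

module Brick {n : ℕ} (E : Fin n → Fin n → Set) (sym-E : ∀ a b → E a b → E b a)
             (irrefl-E : ∀ a → ¬ E a a) (cubic : Cubic (mkGraph (Fin n) E))
             (v : Fin n) (w : Fin 3 → Fin n) (w-inj : ∀ i j → w i ≡ w j → i ≡ j) (vw : ∀ j → E v (w j))
             (x y : Fin n) (xy : E x y)
             (far-x : Dist≥ (mkGraph (Fin n) E) 3 v x) (far-y : Dist≥ (mkGraph (Fin n) E) 3 v y) where

  open CubicGraph E sym-E irrefl-E cubic public

  tv : Term → Fin n
  tv (W j) = w j
  tv X = x
  tv Y = y

  -- The end outside the brick of the edge of G that is cut at a terminal.
  partner : Term → Fin n
  partner (W _) = v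
  partner X = y
  partner Y = x

  tv-partner : ∀ τ → E (tv τ) (partner τ)
  tv-partner (W j) = sym-E _ _ (vw j)
  tv-partner X = xy
  tv-partner Y = sym-E _ _ xy

  -- Any further neighbour would give `v` four distinct ones.
  nb-v : ∀ {b} → E v b → ∃[ j ] b ≡ w j
  nb-v {b} vb with Fin.any? (λ j → b Fin.≟ w j)
  ... | yes h = h
  ... | no h = ⊥-elim (<⇒≱ {3} {4} ≤-refl
      (subst (4 ≤_) (length-map (nb v) (allFin 3))
      (unique-⊆-length {xs = b ∷ map w (allFin 3)} {ys = map (nb v) (allFin 3)} u sub)))
    where
    u : Unique (b ∷ map w (allFin 3))
    u = unique-∷ (λ i → let (j , _ , e) = ∈-map⁻ w i in h (j , e)) (Unique.map⁺ (λ {i} {j} → w-inj i j) (Unique.allFin⁺ 3))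
    nbr : ∀ {a} → E v a → a ∈ map (nb v) (allFin 3)
    nbr va with nb-all va
    ... | k , refl = ∈-map⁺ (nb v) (∈-allFin k)
    sub : ∀ {a} → a ∈ b ∷ map w (allFin 3) → a ∈ map (nb v) (allFin 3)
    sub (here refl) = nbr vb
    sub (there i) with ∈-map⁻ w i
    ... | j , _ , refl = nbr (vw j)

  x≢w : ∀ j → x ≢ w j
  x≢w j refl = far-x 1 (s≤s (s≤s z≤n)) (cons (vw j) (nil _))

  y≢w : ∀ j → y ≢ w j
  y≢w j refl = far-y 1 (s≤s (s≤s z≤n)) (cons (vw j) (nil _))

  x≢y : x ≢ y
  x≢y refl = irrefl-E _ xy

  tv-inj : ∀ {τ τ′} → tv τ ≡ tv τ′ → τ ≡ τ′
  tv-inj {W i} {W j} e = cong W (w-inj i j e)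
  tv-inj {W i} {X} e = ⊥-elim (x≢w i (sym e))
  tv-inj {W i} {Y} e = ⊥-elim (y≢w i (sym e))
  tv-inj {X} {W j} e = ⊥-elim (x≢w j e)
  tv-inj {X} {X} e = refl
  tv-inj {X} {Y} e = ⊥-elim (x≢y e)
  tv-inj {Y} {W j} e = ⊥-elim (y≢w j e)
  tv-inj {Y} {X} e = ⊥-elim (x≢y (sym e))
  tv-inj {Y} {Y} e = refl

  tv≢v : ∀ τ → tv τ ≢ v
  tv≢v (W j) e = irrefl-E v (subst (E v) e (vw j))
  tv≢v X refl = far-x 0 (s≤s z≤n) (nil _)
  tv≢v Y refl = far-y 0 (s≤s z≤n) (nil _)

  tvB : ∀ τ → False (tv τ Fin.≟ v)
  tvB τ = fromWitnessFalse (tv≢v τ)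

  -- This is where distance three counts: such an edge would give a walk of length two from `v` to x
  -- or y.
  far-xy : ∀ j τ → (∀ i → τ ≢ W i) → ¬ E (w j) (tv τ)
  far-xy j (W i) h e = h i refl
  far-xy j X h e = far-x 2 (s≤s (s≤s (s≤s z≤n))) (cons (vw j) (cons e (nil _)))
  far-xy j Y h e = far-y 2 (s≤s (s≤s (s≤s z≤n))) (cons (vw j) (cons e (nil _)))

  IsXY : Fin n → Fin n → Set
  IsXY a b = (a ≡ x × b ≡ y) ⊎ (a ≡ y × b ≡ x)

  isXY? : ∀ a b → Dec (IsXY a b)
  isXY? a b = ((a Fin.≟ x) ×-dec (b Fin.≟ y)) ⊎-dec ((a Fin.≟ y) ×-dec (b Fin.≟ x))

  InnerCover : Sub n → List (Fin n × Fin n) → Set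
  InnerCover S P = ∀ a b → S a ≡ true → S b ≡ false → a ≢ v → b ≢ v → E a b → ¬ IsXY a b → (a , b) ∈ P ⊎ (b , a) ∈ P

  orient : Sub n → Fin n × Fin n → Fin n × Fin n
  orient S (a , b) = if S a then (a , b) else (b , a)

  orient-cover : ∀ {S P} a b → S a ≡ true → S b ≡ false → (a , b) ∈ P ⊎ (b , a) ∈ P → (a , b) ∈ map (orient S) P
  orient-cover {S} {P} a b Sa Sb (inj₁ i) = subst (_∈ map (orient S) P) e (∈-map⁺ (orient S) i)
    where
    e : orient S (a , b) ≡ (a , b)
    e rewrite Sa = refl
  orient-cover {S} {P} a b Sa Sb (inj₂ i) = subst (_∈ map (orient S) P) e (∈-map⁺ (orient S) i)
    where
    e : orient S (b , a) ≡ (a , b)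
    e rewrite Sb = refl

  in? : (S : Sub n) → Decidable (λ τ → S (tv τ) ≡ true)
  in? S τ = S (tv τ) Bool.≟ true

  termsIn termsOut : Sub n → List Term
  termsIn S = filter (in? S) terms
  termsOut S = filter (¬? ∘ in? S) terms

  ∈-termsIn : ∀ (S : Sub n) τ → S (tv τ) ≡ true → τ ∈ termsIn S
  ∈-termsIn S τ e = ∈-filter⁺ (in? S) (∈-terms τ) e

  ∈-termsIn⁻ : ∀ (S : Sub n) {τ} → τ ∈ termsIn S → S (tv τ) ≡ true
  ∈-termsIn⁻ S i = proj₂ (∈-filter⁻ (in? S) {xs = terms} i)

  cutTerm : Term → Fin n × Fin n
  cutTerm τ = tv τ , partner τ

  -- Back in G every terminal in `S` regains its edge to its `partner`. With `v` outside `S`, no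
  -- other edge can join the boundary, so the cut of G has at most `length P` plus the number of
  -- terminals in `S`.
  fullCover : Sub n → List (Fin n × Fin n) → List (Fin n × Fin n)
  fullCover S P = map (orient S) P ++ map cutTerm (termsIn S)

  fullCover-length : ∀ S P → length (fullCover S P) ≡ length P + length (termsIn S)
  fullCover-length S P = trans (length-++ (map (orient S) P)) (cong₂ _+_ (length-map (orient S) P) (length-map cutTerm (termsIn S)))

  fullCover-cover : ∀ {S P} → S v ≡ false → InnerCover S P → Cover S (fullCover S P)
  fullCover-cover {S} {P} Sv ic a b Sa Sb ab with b Fin.≟ v | isXY? a b
  ... | yes refl | _ with nb-v (sym-E _ _ ab)
  ...   | j , refl = ∈-++⁺ʳ (map (orient S) P) (∈-map⁺ cutTerm (∈-termsIn S (W j) Sa))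
  fullCover-cover {S} {P} Sv ic a b Sa Sb ab | no b≢v | yes (inj₁ (refl , refl)) =
    ∈-++⁺ʳ (map (orient S) P) (∈-map⁺ cutTerm (∈-termsIn S X Sa))
  fullCover-cover {S} {P} Sv ic a b Sa Sb ab | no b≢v | yes (inj₂ (refl , refl)) =
    ∈-++⁺ʳ (map (orient S) P) (∈-map⁺ cutTerm (∈-termsIn S Y Sa))
  fullCover-cover {S} {P} Sv ic a b Sa Sb ab | no b≢v | no ¬xy =
    ∈-++⁺ˡ (orient-cover a b Sa Sb (ic a b Sa Sb (λ { refl → true≢false Sa Sv }) b≢v ab ¬xy))

  outer : Sub n → List (Fin n)
  outer S = map tv (termsOut S)

  outer-unique : ∀ S → Unique (outer S)
  outer-unique S = Unique.map⁺ tv-inj (Unique.filter⁺ (¬? ∘ in? S) terms-unique)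

  outer-out : ∀ S {a} → a ∈ outer S → S a ≡ false × ∃[ τ ] a ≡ tv τ
  outer-out S i with ∈-map⁻ tv i
  ... | τ , j , refl with S (tv τ) in e
  ...   | false = refl , τ , refl
  ...   | true = ⊥-elim (proj₂ (∈-filter⁻ (¬? ∘ in? S) {xs = terms} j) e)

  -- Three of the five terminals stay outside; as witnesses they make the complement of `S` large
  -- enough for cuts of up to four edges.
  outer-length : ∀ S → length (termsIn S) ≤ 2 → 3 ≤ length (outer S)
  outer-length S k2 = subst (3 ≤_) (sym (length-map tv (termsOut S)))
    (+-cancelˡ-≤ 2 3 (length (termsOut S)) (≤-trans (≤-reflexive (sym (length-filter-partition (in? S) terms)))
      (+-monoˡ-≤ (length (termsOut S)) k2)))

  module _ (cyc4 : CyclicallyConnected 4 G)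
           (cuts4 : ∀ (C : EdgeList G) → length C ≡ 4 → DistinctEdges G C → IsCyclicEdgeCut G C →
                    (∀ {a b} → (a , b) ∈ C → a ≢ v × b ≢ v × a ≢ x × b ≢ x) × ¬ Connected (deleteEdges G C) v x) where

    -- Otherwise splitting the side of v and x into the component of v and the rest
    -- would leave a cut of at most two edges.
    connected-complement : ∀ S C s → Cover S C → IsBoundary S C → length C ≤ 4 → S s ≡ true → S v ≡ false → S x ≡ false →
      ¬ ¬ Connected (deleteEdges G C) v x
    connected-complement S C s cov bd C4 Ss Sv Sx ¬con = ¬¬-∀Fin (λ a → ¬¬-excluded-middle {A = Connected (deleteEdges G C) v a}) go
      where
      go : (∀ a → Dec (Connected (deleteEdges G C) v a)) → ⊥
      -- Each edge of `C` ends either in the component `R` of `v` or in the rest `Q` of the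
      -- complement. As `C` has at most four edges, one of these sets is bounded by at most two, for
      -- which one vertex on each side suffices.
      go reach? = split (length (filter to? C) ≤? 2)
        where
        to? : Decidable (λ e → Connected (deleteEdges G C) v (proj₂ e))
        to? e = reach? (proj₂ e)
        R Q : Sub n
        R a = does (reach? a)
        Q a = not (S a) ∧ not (R a)
        R-true : ∀ {a} → Connected (deleteEdges G C) v a → R a ≡ true
        R-true {a} c with reach? a
        ... | yes _ = refl
        ... | no h = ⊥-elim (h c)
        R-true⁻ : ∀ {a} → R a ≡ true → Connected (deleteEdges G C) v a
        R-true⁻ {a} e with reach? a
        ... | yes c = c
        R-false⁻ : ∀ {a} → R a ≡ false → ¬ Connected (deleteEdges G C) v a
        R-false⁻ {a} e with reach? a
        ... | no h = h
        R-out : ∀ {a} → Connected (deleteEdges G C) v a → S a ≡ false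
        R-out (_ , wk) = trans (sym (walk-side cov wk)) Sv
        Q-true⁻ : ∀ {a} → Q a ≡ true → S a ≡ false × R a ≡ false
        Q-true⁻ {a} e with S a | R a
        ... | false | false = refl , refl
        Q-out : ∀ {a} → S a ≡ true → Q a ≡ false
        Q-out e rewrite e = refl
        edge : ∀ a b → E a b → S a ≡ false → (b , a) ∈ C ⊎ Adj (deleteEdges G C) a b
        edge a b ab Sa with (b , a) ∈ₑ? C | (a , b) ∈ₑ? C
        ... | yes i | _ = inj₁ i
        ... | no _ | yes i = ⊥-elim (true≢false (proj₁ (bd i)) Sa)
        ... | no j | no i = inj₂ (ab , i , j)
        del-sym : ∀ {a b} → Adj (deleteEdges G C) a b → Adj (deleteEdges G C) b a
        del-sym (ab , p , q) = sym-E _ _ ab , q , p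
        coverR : Cover R (map swap (filter to? C))
        coverR a b Ra Rb ab with edge a b ab (R-out (R-true⁻ Ra))
        ... | inj₁ i = ∈-map⁺ swap (∈-filter⁺ to? i (R-true⁻ Ra))
        ... | inj₂ e = ⊥-elim (R-false⁻ Rb (walk-snoc (proj₂ (R-true⁻ Ra)) e))
        coverQ : Cover Q (map swap (filter (¬? ∘ to?) C))
        coverQ a b Qa Qb ab with Q-true⁻ Qa
        ... | Sa , Ra with edge a b ab Sa
        ...   | inj₁ i = ∈-map⁺ swap (∈-filter⁺ (¬? ∘ to?) i (R-false⁻ Ra))
        ...   | inj₂ e with S b in Sb | R b in Rb
        ...     | true | _ = ⊥-elim (true≢false Sb (trans (sym (walk-side {S} {C} cov (cons e (nil _)))) Sa))
        ...     | false | true = ⊥-elim (R-false⁻ Ra (walk-snoc (proj₂ (R-true⁻ Rb)) (del-sym e)))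
        ...     | false | false = ⊥-elim (true≢false refl Qb)
        small : ∀ {T : Sub n} {D} a → Cover T (map swap D) → length D ≤ 2 → T a ≡ true → T s ≡ false → ⊥
        small {T} {D} a c D2 Ta Ts = no-small-cut cyc4 T (map swap D) (a ∷ []) (s ∷ []) c
          (≤-trans len (s≤s (s≤s z≤n))) ([] ∷ []) (λ { (here refl) → Ta }) (s≤s z≤n) len
          ([] ∷ []) (λ { (here refl) → cong not Ts }) (s≤s z≤n) len
          where
          len : length (map swap D) ≤ 2
          len = ≤-trans (≤-reflexive (length-map swap D)) D2
        split : Dec (length (filter to? C) ≤ 2) → ⊥
        split (yes p) = small {R} v coverR p (R-true (0 , nil v)) (Rs (R s) refl)
          where
          Rs : ∀ b → R s ≡ b → b ≡ false
          Rs false _ = refl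
          Rs true e = ⊥-elim (true≢false Ss (R-out (R-true⁻ e)))
        split (no p) = small {Q} x coverQ len (Qx (R x) refl) (Q-out Ss)
          where
          Qx : ∀ b → R x ≡ b → Q x ≡ true
          Qx true e = ⊥-elim (¬con (R-true⁻ e))
          Qx false e rewrite Sx | e = refl
          len : length (filter (¬? ∘ to?) C) ≤ 2
          len = +-cancelˡ-≤ 3 _ 2 (≤-trans (+-monoˡ-≤ _ (≰⇒> p))
            (≤-trans (≤-reflexive (length-filter-partition to? C)) (≤-trans C4 (n≤1+n 4))))

    module _ (S : Sub n) (P : List (Fin n × Fin n)) (Sv : S v ≡ false) (ic : InnerCover S P)
             (k2 : length (termsIn S) ≤ 2) where

      L : List (Fin n × Fin n)
      L = fullCover S P

      outer-compl : outer S ⊆ₗ compl S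
      outer-compl i = cong not (proj₁ (outer-out S i))

      outer≥1 : 1 ≤ length (outer S)
      outer≥1 = ≤-trans (s≤s z≤n) (outer-length S k2)

      -- x and y use up the two terminals allowed, so no w lies in `S`, and the edge xy runs within
      -- `S`: nothing has to be added to `P`.
      uncut-xy : S x ≡ true → S y ≡ true → Cover S (map (orient S) P)
      uncut-xy Sx Sy a b Sa Sb ab with b Fin.≟ v | isXY? a b
      ... | _ | yes (inj₁ (_ , refl)) = ⊥-elim (true≢false Sy Sb)
      ... | _ | yes (inj₂ (_ , refl)) = ⊥-elim (true≢false Sx Sb)
      ... | no b≢v | no ¬xy = orient-cover a b Sa Sb (ic a b Sa Sb (λ { refl → true≢false Sa Sv }) b≢v ab ¬xy)
      ... | yes refl | _ with nb-v (sym-E _ _ ab)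
      ...   | j , refl = ⊥-elim (<⇒≱ {2} {3} ≤-refl (≤-trans
                (unique-⊆-length {xs = X ∷ Y ∷ W j ∷ []} {ys = termsIn S}
                  (((λ ()) ∷ (λ ()) ∷ []) ∷ ((λ ()) ∷ []) ∷ [] ∷ [])
                  λ { (here refl) → ∈-termsIn S X Sx ; (there (here refl)) → ∈-termsIn S Y Sy
                    ; (there (there (here refl))) → ∈-termsIn S (W j) Sa }) k2))

      no-xy : ∀ s → S s ≡ true → length P ≤ 2 → S x ≡ true → S y ≡ true → ⊥
      no-xy s Ss P2 Sx Sy = no-small-cut cyc4 S (map (orient S) P) (s ∷ []) (outer S) (uncut-xy Sx Sy)
        (≤-trans len (s≤s (s≤s z≤n))) ([] ∷ []) (λ { (here refl) → Ss }) (s≤s z≤n) len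
        (outer-unique S) outer-compl outer≥1 (≤-trans len (s≤s outer≥1))
        where
        len : length (map (orient S) P) ≤ 2
        len = ≤-trans (≤-reflexive (length-map (orient S) P)) P2

      -- Three vertices in `S` would yield a cyclic cut of G with exactly four edges. If x is
      -- outside `S`, it is connected to `v` there, against the hypothesis on 4-cuts. If x is in
      -- `S`, so is y, because no cut edge ends at x; then at most two edges separate `S`.
      sparse⇒≤2 : length P + length (termsIn S) ≤ 4 → ∀ U → Unique U → U ⊆ₗ S → length U ≤ 2
      sparse⇒≤2 c4 U uU US with length U ≤? 2
      ... | yes p = p
      ... | no p = ⊥-elim (go (S x) refl)
        where
        U3 : 3 ≤ length U
        U3 = ≰⇒> p
        L4 : length L ≤ 4
        L4 = ≤-trans (≤-reflexive (fullCover-length S P)) c4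
        cov : Cover S L
        cov = fullCover-cover {S} {P} Sv ic
        C = boundary S L
        C4 : length C ≤ 4
        C4 = ≤-trans (boundary-length S L) L4
        cut : IsCyclicEdgeCut G C
        cut = boundary-cyclicCut S L cov
          (cycleIn (length L) S L U cov ≤-refl uU US (≤-trans (s≤s z≤n) U3) (≤-trans L4 (s≤s U3)))
          (cycleIn (length L) (compl S) (map swap L) (outer S) (compl-cover {S} cov) (≤-reflexive (length-map swap L))
            (outer-unique S) outer-compl outer≥1
            (≤-trans (≤-reflexive (length-map swap L)) (≤-trans L4 (s≤s (outer-length S k2)))))
        C≡4 : length C ≡ 4
        C≡4 = ≤-antisym C4 (≮⇒≥ (λ lt → cyc4 C lt cut))
        hyp = cuts4 C C≡4 (boundary-distinct S L) cut
        s : ∃[ s ] S s ≡ true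
        s = nonempty U US U3
          where
          nonempty : ∀ U → U ⊆ₗ S → 3 ≤ length U → ∃[ s ] S s ≡ true
          nonempty (s ∷ _) h _ = s , h (here refl)
        go : ∀ b → S x ≡ b → ⊥
        go false Sx = connected-complement S C (proj₁ s) (boundary-cover S L cov) (boundary-isBoundary S L) C4
                        (proj₂ s) Sv Sx (proj₂ hyp)
        go true Sx = no-xy x Sx P2 Sx Sy
          where
          Sy : S y ≡ true
          Sy with S y in e
          ... | true = refl
          ... | false = ⊥-elim (proj₁ (proj₂ (proj₂ (proj₁ hyp (boundary-cover S L cov x y Sx e xy)))) refl)
          P2 : length P ≤ 2
          P2 = +-cancelʳ-≤ 2 (length P) 2 (≤-trans (+-monoʳ-≤ (length P)
            (unique-⊆-length {xs = X ∷ Y ∷ []} {ys = termsIn S} (((λ ()) ∷ []) ∷ [] ∷ [])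
              λ { (here refl) → ∈-termsIn S X Sx ; (there (here refl)) → ∈-termsIn S Y Sy })) c4)

      unique-terms : ∀ {T} → termsIn S ≡ T → Unique T
      unique-terms e = subst Unique e (Unique.filter⁺ (in? S) terms-unique)

      few-terms : length P ≤ 2 → length (termsIn S) ≤ 1 → ∀ s s′ → s ≢ s′ → S s ≡ true → S s′ ≡ true → ⊥
      few-terms P2 k1 s s′ ne Ss Ss′ = no-small-cut cyc4 S L (s ∷ s′ ∷ []) (outer S) (fullCover-cover {S} {P} Sv ic) L3
        ((ne ∷ []) ∷ [] ∷ []) (λ { (here refl) → Ss ; (there (here refl)) → Ss′ }) (s≤s z≤n) L3
        (outer-unique S) outer-compl outer≥1 (≤-trans L3 (≤-trans (outer-length S k2) (n≤1+n _)))
        where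
        L3 : length L ≤ 3
        L3 = ≤-trans (≤-reflexive (fullCover-length S P)) (+-mono-≤ P2 k1)

      -- The two terminals next to v form a small cut together with v.
      two-w : length P ≤ 2 → ∀ s s′ → s ≢ s′ → S s ≡ true → S s′ ≡ true → S x ≡ false → S y ≡ false →
        ∀ j j′ → j ≢ j′ → S (w j) ≡ true → S (w j′) ≡ true → ⊥
      two-w P2 s s′ ne Ss Ss′ Sx Sy j j′ j≢j′ Sj Sj′ with third j j′ j≢j′
      ... | l , all3 = no-small-cut cyc4 S⁺ L⁺ (v ∷ s ∷ s′ ∷ []) (outer S) cov L3
        ((≢v Ss ∷ ≢v Ss′ ∷ []) ∷ (ne ∷ []) ∷ [] ∷ [])
        (λ { (here refl) → S⁺v ; (there (here refl)) → S⁺-in (≢v Ss) Ss ; (there (there (here refl))) → S⁺-in (≢v Ss′) Ss′ })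
        (s≤s z≤n) (≤-trans L3 (n≤1+n 3)) (outer-unique S) out outer≥1 (≤-trans L3 (≤-trans (outer-length S k2) (n≤1+n _)))
        where
        S⁺ : Sub n
        S⁺ a = if does (a Fin.≟ v) then true else S a
        ≢v : ∀ {a} → S a ≡ true → v ≢ a
        ≢v Sa refl = true≢false Sa Sv
        S⁺v : S⁺ v ≡ true
        S⁺v with v Fin.≟ v
        ... | yes _ = refl
        ... | no h = ⊥-elim (h refl)
        S⁺-in : ∀ {a} → v ≢ a → S a ≡ true → S⁺ a ≡ true
        S⁺-in {a} ne Sa with a Fin.≟ v
        ... | yes _ = refl
        ... | no _ = Sa
        out : outer S ⊆ₗ compl S⁺
        out {a} i with outer-out S i
        ... | Sa , τ , refl with tv τ Fin.≟ v
        ...   | yes e = ⊥-elim (tv≢v τ e)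
        ...   | no _ = cong not Sa
        L⁺ = (v , w l) ∷ map (orient S) P
        L3 : length L⁺ ≤ 3
        L3 = s≤s (≤-trans (≤-reflexive (length-map (orient S) P)) P2)
        cov : Cover S⁺ L⁺
        cov a b Sa Sb ab with a Fin.≟ v | b Fin.≟ v
        ... | _ | yes _ = ⊥-elim (true≢false refl Sb)
        ... | no a≢v | no b≢v with isXY? a b
        ...   | yes (inj₁ (refl , _)) = ⊥-elim (true≢false Sa Sx)
        ...   | yes (inj₂ (refl , _)) = ⊥-elim (true≢false Sa Sy)
        ...   | no ¬xy = there (orient-cover a b Sa Sb (ic a b Sa Sb a≢v b≢v ab ¬xy))
        cov a b Sa Sb ab | yes refl | no b≢v with nb-v ab
        ... | i , refl with all3 i
        ...   | inj₁ refl = ⊥-elim (true≢false Sj Sb)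
        ...   | inj₂ (inj₁ refl) = ⊥-elim (true≢false Sj′ Sb)
        ...   | inj₂ (inj₂ refl) = here refl

      -- Being non-adjacent, the two terminals would have six boundary edges in G.
      w-and-xy : length P ≤ 2 → ∀ j τ → (∀ i → τ ≢ W i) → S (w j) ≡ true → S (tv τ) ≡ true → ⊥
      w-and-xy P2 j τ τ≢W Sj Sτ = <⇒≱ {4} {6} (s≤s (s≤s (s≤s (s≤s (s≤s z≤n)))))
        (≤-trans (unique-⊆-length {xs = six} {ys = L} six-unique sub) (≤-trans (≤-reflexive (fullCover-length S P)) c4))
        where
        c4 : length P + length (termsIn S) ≤ 4
        c4 = +-mono-≤ P2 k2
        star : Fin n → List (Fin n × Fin n)
        star a = map (λ i → a , nb a i) (allFin 3)
        six = star (w j) ++ star (tv τ)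
        wj≢tv : w j ≢ tv τ
        wj≢tv e = τ≢W j (sym (tv-inj {W j} e))
        star-fst : ∀ a {e} → e ∈ star a → ∃[ i ] e ≡ (a , nb a i)
        star-fst a i with ∈-map⁻ (λ i → a , nb a i) i
        ... | k , _ , e = k , e
        star-unique : ∀ a → Unique (star a)
        star-unique a = Unique.map⁺ {f = λ i → a , nb a i} (λ {i} {l} e → nb-inj a {i} {l} (cong proj₂ e)) (Unique.allFin⁺ 3)
        six-unique : Unique six
        six-unique = Unique.++⁺ (star-unique (w j)) (star-unique (tv τ)) λ { (p , q) →
          wj≢tv (trans (sym (cong proj₁ (proj₂ (star-fst (w j) p)))) (cong proj₁ (proj₂ (star-fst (tv τ) q)))) }
        -- By `sparse⇒≤2` the two terminals are all of `S`, so every edge at either of them leaves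
        -- `S`.
        only : ∀ {a} → a ≢ w j → a ≢ tv τ → S a ≡ false
        only {a} p q with S a in e
        ... | false = refl
        ... | true = ⊥-elim (<⇒≱ {2} {3} ≤-refl (sparse⇒≤2 c4 (a ∷ w j ∷ tv τ ∷ [])
                ((p ∷ q ∷ []) ∷ (wj≢tv ∷ []) ∷ [] ∷ [])
                λ { (here refl) → e ; (there (here refl)) → Sj ; (there (there (here refl))) → Sτ }))
        not-self : ∀ a i → nb a i ≢ a
        not-self a i e = irrefl-E a (subst (E a) e (nb-adj a i))
        sub : ∀ {e} → e ∈ six → e ∈ L
        sub i with ∈-++⁻ (star (w j)) i
        ... | inj₁ p with star-fst (w j) p
        ...   | l , refl = fullCover-cover {S} {P} Sv ic _ _ Sj
                  (only (not-self (w j) l) (λ e → far-xy j τ τ≢W (subst (E (w j)) e (nb-adj (w j) l)))) (nb-adj (w j) l)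
        sub i | inj₂ p with star-fst (tv τ) p
        ...   | l , refl = fullCover-cover {S} {P} Sv ic _ _ Sτ
                  (only (λ e → far-xy j τ τ≢W (sym-E _ _ (subst (E (tv τ)) e (nb-adj (tv τ) l)))) (not-self (tv τ) l)) (nb-adj (tv τ) l)

      -- The cases follow the terminals in `S`. At most one gives a cut of three edges. Two w's are
      -- joined through `v`, x and y through their own edge, and a mixed pair is too far apart to be
      -- adjacent.
      two-cut⇒≤1 : length P ≤ 2 → ∀ s s′ → S s ≡ true → S s′ ≡ true → s ≡ s′
      two-cut⇒≤1 P2 s s′ Ss Ss′ with s Fin.≟ s′
      ... | yes e = e
      ... | no ne = ⊥-elim (go (termsIn S) refl)
        where
        mem : ∀ {T τ} → termsIn S ≡ T → τ ∈ T → S (tv τ) ≡ true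
        mem e i = ∈-termsIn⁻ S (subst (_ ∈_) (sym e) i)
        nonmem : ∀ {T} τ → termsIn S ≡ T → ¬ (τ ∈ T) → S (tv τ) ≡ false
        nonmem τ e h with S (tv τ) in q
        ... | false = refl
        ... | true = ⊥-elim (h (subst (τ ∈_) e (∈-termsIn S τ q)))
        dup : ∀ {τ T} → termsIn S ≡ τ ∷ τ ∷ T → ⊥
        dup e with unique-terms e
        ... | (h ∷ _) ∷ _ = h refl
        go : ∀ T → termsIn S ≡ T → ⊥
        go [] e = few-terms P2 (≤-trans (≤-reflexive (cong length e)) z≤n) s s′ ne Ss Ss′
        go (_ ∷ []) e = few-terms P2 (≤-reflexive (cong length e)) s s′ ne Ss Ss′
        go (_ ∷ _ ∷ _ ∷ _) e = <⇒≱ {2} {3} ≤-refl (≤-trans (s≤s (s≤s (s≤s z≤n))) (≤-trans (≤-reflexive (sym (cong length e))) k2))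
        go (W i ∷ W j ∷ []) e = two-w P2 s s′ ne Ss Ss′ (nonmem X e (λ { (there (there ())) })) (nonmem Y e (λ { (there (there ())) }))
          i j (λ { refl → dup e }) (mem e (here refl)) (mem e (there (here refl)))
        go (W i ∷ X ∷ []) e = w-and-xy P2 i X (λ _ ()) (mem e (here refl)) (mem e (there (here refl)))
        go (W i ∷ Y ∷ []) e = w-and-xy P2 i Y (λ _ ()) (mem e (here refl)) (mem e (there (here refl)))
        go (X ∷ W i ∷ []) e = w-and-xy P2 i X (λ _ ()) (mem e (there (here refl))) (mem e (here refl))
        go (Y ∷ W i ∷ []) e = w-and-xy P2 i Y (λ _ ()) (mem e (there (here refl))) (mem e (here refl))
        go (X ∷ Y ∷ []) e = no-xy x (mem e (here refl)) P2 (mem e (here refl)) (mem e (there (here refl)))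
        go (Y ∷ X ∷ []) e = no-xy x (mem e (there (here refl))) P2 (mem e (there (here refl))) (mem e (here refl))
        go (X ∷ X ∷ []) e = dup e
        go (Y ∷ Y ∷ []) e = dup e

      -- With one inner cut edge and at most one terminal, G would have a cut of two edges. Two
      -- terminals would be two vertices of `S`, against `two-cut⇒≤1`.
      two-edge-connected : ∀ s → S s ≡ true → 2 ≤ length P
      two-edge-connected s Ss with 2 ≤? length P
      ... | yes p = p
      ... | no np = ⊥-elim (go (termsIn S) refl)
        where
        P1 : length P ≤ 1
        P1 = ≤-pred (≰⇒> np)
        few : length (termsIn S) ≤ 1 → ⊥
        few k1 = no-small-cut cyc4 S L (s ∷ []) (outer S) (fullCover-cover {S} {P} Sv ic) (≤-trans L2 (n≤1+n 2))
          ([] ∷ []) (λ { (here refl) → Ss }) (s≤s z≤n) L2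
          (outer-unique S) outer-compl outer≥1 (≤-trans L2 (s≤s outer≥1))
          where
          L2 : length L ≤ 2
          L2 = ≤-trans (≤-reflexive (fullCover-length S P)) (+-mono-≤ P1 k1)
        go : ∀ T → termsIn S ≡ T → ⊥
        go [] e = few (≤-trans (≤-reflexive (cong length e)) z≤n)
        go (_ ∷ []) e = few (≤-reflexive (cong length e))
        go (τ ∷ τ′ ∷ T) e with unique-terms e
        ... | (ne ∷ _) ∷ _ = ne (tv-inj (two-cut⇒≤1 (≤-trans P1 (n≤1+n 1)) (tv τ) (tv τ′)
                (∈-termsIn⁻ S (subst (τ ∈_) (sym e) (here refl)))
                (∈-termsIn⁻ S (subst (τ′ ∈_) (sym e) (there (here refl))))))

-- Counting cut edges over the darts of M

module _ {A : Set} where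

  ∑ : List A → (A → ℕ) → ℕ
  ∑ xs f = sum (map f xs)

  ∑-mono : ∀ {f g : A → ℕ} xs → (∀ a → f a ≤ g a) → ∑ xs f ≤ ∑ xs g
  ∑-mono [] h = z≤n
  ∑-mono (x ∷ xs) h = +-mono-≤ (h x) (∑-mono xs h)

  ∑-+ : ∀ (f g : A → ℕ) xs → ∑ xs (λ a → f a + g a) ≡ ∑ xs f + ∑ xs g
  ∑-+ f g [] = refl
  ∑-+ f g (x ∷ xs) = trans (cong (f x + g x +_) (∑-+ f g xs)) (lemma (f x) (g x) (∑ xs f) (∑ xs g))
    where
    lemma : ∀ a b c d → a + b + (c + d) ≡ a + c + (b + d)
    lemma = solve-∀

  ∑-++ : ∀ (f : A → ℕ) xs ys → ∑ (xs ++ ys) f ≡ ∑ xs f + ∑ ys f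
  ∑-++ f xs ys = trans (cong sum (map-++ f xs ys)) (sum-++ (map f xs) (map f ys))

  ∑-⊆ : ∀ (f : A → ℕ) {xs ys} → Unique xs → (∀ {a} → a ∈ xs → a ∈ ys) → ∑ xs f ≤ ∑ ys f
  ∑-⊆ f {[]} u s = z≤n
  ∑-⊆ f {x ∷ xs} u@(_ ∷ u′) s with unique-⊆-remove u s
  ... | zs , perm , sub = subst (f x + ∑ xs f ≤_) (sym (sum-↭ (map⁺ f perm))) (+-monoʳ-≤ (f x) (∑-⊆ f u′ sub))

  ∑-∈ : ∀ (f : A → ℕ) {x xs} → x ∈ xs → f x ≤ ∑ xs f
  ∑-∈ f {x} {xs} i = subst (_≤ ∑ xs f) (+-identityʳ (f x)) (∑-⊆ f {x ∷ []} ([] ∷ []) λ { (here refl) → i })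

  ∑-∈₂ : ∀ (f : A → ℕ) {x y xs} → x ≢ y → x ∈ xs → y ∈ xs → f x + f y ≤ ∑ xs f
  ∑-∈₂ f {x} {y} {xs} ne i j = subst (λ k → f x + k ≤ ∑ xs f) (+-identityʳ (f y))
    (∑-⊆ f {x ∷ y ∷ []} ((ne ∷ []) ∷ [] ∷ []) λ { (here refl) → i ; (there (here refl)) → j })

  ∑-0 : ∀ xs → ∑ xs (λ (_ : A) → 0) ≡ 0
  ∑-0 [] = refl
  ∑-0 (x ∷ xs) = ∑-0 xs

∑-comm : ∀ {A B : Set} (f : A → B → ℕ) xs ys → ∑ xs (λ a → ∑ ys (f a)) ≡ ∑ ys (λ b → ∑ xs (λ a → f a b))
∑-comm f [] ys = sym (∑-0 ys)
∑-comm f (x ∷ xs) ys = trans (cong (∑ ys (f x) +_) (∑-comm f xs ys)) (sym (∑-+ (f x) (λ b → ∑ xs (λ a → f a b)) ys))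

∑-cartesianProduct : ∀ {A B : Set} (f : A × B → ℕ) xs ys →
  ∑ (cartesianProduct xs ys) f ≡ ∑ xs (λ a → ∑ ys (λ b → f (a , b)))
∑-cartesianProduct f [] ys = refl
∑-cartesianProduct f (x ∷ xs) ys = trans (∑-++ f (map (x ,_) ys) (cartesianProduct xs ys))
  (cong₂ _+_ (cong sum (sym (map-∘ ys))) (∑-cartesianProduct f xs ys))

-- Exhaustive Boolean checks and the metric on two colours

allVec : ∀ k → (Vec Bool k → Bool) → Bool
allVec zero f = f Vec.[]
allVec (suc k) f = allVec k (λ v → f (true Vec.∷ v)) ∧ allVec k (λ v → f (false Vec.∷ v))

∧-true⁻ : ∀ {a b} → a ∧ b ≡ true → a ≡ true × b ≡ true
∧-true⁻ {true} {true} _ = refl , refl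

-- Reduces a statement about a few Booleans to a single evaluation, settled by `refl`.
allVec-sound : ∀ k f → allVec k f ≡ true → ∀ v → f v ≡ true
allVec-sound zero f e Vec.[] = e
allVec-sound (suc k) f e (true Vec.∷ v) = allVec-sound k _ (proj₁ (∧-true⁻ e)) v
allVec-sound (suc k) f e (false Vec.∷ v) = allVec-sound k _ (proj₂ (∧-true⁻ {allVec k _} e)) v

≤ᵇ-true : ∀ {a b} → (a ≤ᵇ b) ≡ true → a ≤ b
≤ᵇ-true {a} {b} e = ≤ᵇ⇒≤ a b (subst Bool.T (sym e) tt)

-- The discrete metric on the two colours: with cut edges counted as distances, recolouring
-- arguments become triangle inequalities.
d : Bool → Bool → ℕ
d true true = 0
d true false = 1
d false true = 1
d false false = 0

d-triangle : ∀ a b c → d a c ≤ d a b + d b c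
d-triangle true true c = ≤-refl
d-triangle true false true = z≤n
d-triangle true false false = s≤s z≤n
d-triangle false true true = s≤s z≤n
d-triangle false true false = z≤n
d-triangle false false c = ≤-refl

d-sym : ∀ a b → d a b ≡ d b a
d-sym true true = refl
d-sym true false = refl
d-sym false true = refl
d-sym false false = refl

d-≢ : ∀ {a b} → a ≢ b → d a b ≡ 1
d-≢ {true} {true} ne = ⊥-elim (ne refl)
d-≢ {true} {false} ne = refl
d-≢ {false} {true} ne = refl
d-≢ {false} {false} ne = ⊥-elim (ne refl)

maj5 : (Term → Bool) → Bool
maj5 t = 3 ≤ᵇ ∑ terms (λ τ → d (t τ) false)

minority : (Term → Bool) → ℕ
minority t = ∑ terms (λ τ → d (maj5 t) (t τ))

private
  assign : Vec Bool 5 → Term → Bool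
  assign (a Vec.∷ b Vec.∷ _) X = a
  assign (a Vec.∷ b Vec.∷ _) Y = b
  assign (_ Vec.∷ _ Vec.∷ v) (W j) = Vec.lookup v j

minority≤2 : ∀ t → minority t ≤ 2
minority≤2 t = ≤ᵇ-true (allVec-sound 5 (λ v → minority (assign v) ≤ᵇ 2) refl
  (t X Vec.∷ t Y Vec.∷ t (W zero) Vec.∷ t (W (suc zero)) Vec.∷ t (W (suc (suc zero))) Vec.∷ Vec.[]))

maj₃ : (Fin 3 → Bool) → Bool
maj₃ f = maj3 (f zero) (f (suc zero)) (f (suc (suc zero)))

-- Whatever the colour of a z-vertex, at least as many bricks differ from it as differ from the
-- majority of the three. Summing over three z-vertices gives the factor 3.
K₃₃-cut : ∀ (β ζ : Fin 3 → Bool) →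
  3 * ∑ (allFin 3) (λ i → d (β i) (maj₃ β)) ≤ ∑ (allFin 3) (λ i → ∑ (allFin 3) (λ j → d (β i) (ζ j)))
K₃₃-cut β ζ = ≤ᵇ-true (allVec-sound 6 (λ v → 3 * ∑ (allFin 3) (λ i → d (Vec.lookup (Vec.take 3 v) i) (maj₃ (Vec.lookup (Vec.take 3 v))))
     ≤ᵇ ∑ (allFin 3) (λ i → ∑ (allFin 3) (λ j → d (Vec.lookup (Vec.take 3 v) i) (Vec.lookup (Vec.drop 3 v) j)))) refl
  (β zero Vec.∷ β (suc zero) Vec.∷ β (suc (suc zero)) Vec.∷ ζ zero Vec.∷ ζ (suc zero) Vec.∷ ζ (suc (suc zero)) Vec.∷ Vec.[]))

darts : ∀ m → List (Dart m)
darts m = cartesianProduct (allFin m) (allFin 3)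

∈-darts : ∀ {m} (b : Dart m) → b ∈ darts m
∈-darts (u , i) = ∈-cartesianProduct⁺ (∈-allFin u) (∈-allFin i)

darts-unique : ∀ m → Unique (darts m)
darts-unique m = Unique.cartesianProduct⁺ (Unique.allFin⁺ m) (Unique.allFin⁺ 3)

module _ {m : ℕ} (M : CubicMultigraph m) where

  σ-inj : ∀ {b b′} → σ M b ≡ σ M b′ → b ≡ b′
  σ-inj {b} {b′} e = trans (sym (invol M b)) (trans (cong (σ M) e) (invol M b′))

  ∑-σ : ∀ (f : Dart m → ℕ) → ∑ (darts m) (f ∘ σ M) ≤ ∑ (darts m) f
  ∑-σ f = subst (_≤ ∑ (darts m) f) (cong sum (sym (map-∘ (darts m))))
    (∑-⊆ f (Unique.map⁺ σ-inj (darts-unique m)) (λ _ → ∈-darts _))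

-- t: sides of the terminals of the bricks; ζ: sides of the z-vertices;
-- c, dx, dw: numbers of cut edges inside a brick, on its x-link, and on its edges to the z-vertices.
module Counting {m : ℕ} (M : CubicMultigraph m) (conn : ThreeEdgeConnected M) (u₀ : Fin m)
                (t : Dart m → Term → Bool) (ζ : Fin m → Fin 3 → Bool)
                (c dx : Dart m → ℕ) (dw : Dart m → Fin 3 → ℕ)
                (total : ∑ (darts m) (λ b → c b + (dx b + ∑ (allFin 3) (dw b))) ≤ 4)
                (dx≥ : ∀ b → d (t b X) (t (σ M b) Y) ≤ dx b)
                (dw≥ : ∀ b j → d (t b (W j)) (ζ (proj₁ b) j) ≤ dw b j)
                (c≥2 : ∀ b → 1 ≤ minority (t b) → 2 ≤ c b) where

  D : List (Dart m)
  D = darts m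

  β : Dart m → Bool
  β b = maj5 (t b)

  minority≤c : ∀ b → minority (t b) ≤ c b
  minority≤c b with minority (t b) in e
  ... | zero = z≤n
  ... | suc k = ≤-trans (subst (_≤ 2) e (minority≤2 (t b))) (c≥2 b (subst (1 ≤_) (sym e) (s≤s z≤n)))

  row link : Dart m → ℕ
  row b = ∑ (allFin 3) (λ j → d (β b) (ζ (proj₁ b) j))
  link b = d (β b) (β (σ M b))

  -- Moving the minority terminals of every brick to the other side does not increase the cut.
  uncrossed : ∑ D row + ∑ D link ≤ 4
  uncrossed = begin
    ∑ D row + ∑ D link                               ≡⟨ sym (∑-+ row link D) ⟩
    ∑ D (λ b → row b + link b)                       ≤⟨ ∑-mono D pointwise ⟩
    ∑ D (λ b → (p b + q b) + r (σ M b))              ≡⟨ ∑-+ (λ b → p b + q b) (r ∘ σ M) D ⟩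
    ∑ D (λ b → p b + q b) + ∑ D (r ∘ σ M)            ≤⟨ +-monoʳ-≤ _ (∑-σ M r) ⟩
    ∑ D (λ b → p b + q b) + ∑ D r                    ≡⟨ sym (∑-+ (λ b → p b + q b) r D) ⟩
    ∑ D (λ b → p b + q b + r b)                      ≤⟨ ∑-mono D charge ⟩
    ∑ D (λ b → c b + (dx b + ∑ (allFin 3) (dw b)))   ≤⟨ total ⟩
    4                                                ∎
    where
    open ≤-Reasoning
    -- `p` and `r` together count the minority terminals of `b`. The terminal Y is kept apart
    -- because the link of `b` ends at the Y of its partner brick, so this term arises at `σ M b`
    -- and has to be reindexed.
    pw p q r : Dart m → ℕ
    pw b = ∑ (allFin 3) (λ j → d (β b) (t b (W j)))
    p b = d (β b) (t b X) + pw b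
    q b = dx b + ∑ (allFin 3) (dw b)
    r b = d (β b) (t b Y)
    rows : ∀ b → row b ≤ pw b + ∑ (allFin 3) (dw b)
    rows b = ≤-trans (∑-mono (allFin 3) (λ j → ≤-trans (d-triangle (β b) (t b (W j)) (ζ (proj₁ b) j)) (+-monoʳ-≤ _ (dw≥ b j))))
      (≤-reflexive (∑-+ (λ j → d (β b) (t b (W j))) (dw b) (allFin 3)))
    links : ∀ b → link b ≤ d (β b) (t b X) + (dx b + r (σ M b))
    links b = ≤-trans (d-triangle (β b) (t b X) _) (+-monoʳ-≤ (d (β b) (t b X))
      (≤-trans (d-triangle (t b X) (t (σ M b) Y) _) (+-mono-≤ (dx≥ b) (≤-reflexive (d-sym (t (σ M b) Y) _)))))
    arrange₁ : ∀ a b c e f → (a + b) + (c + (e + f)) ≡ ((c + a) + (e + b)) + f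
    arrange₁ = solve-∀
    pointwise : ∀ b → row b + link b ≤ (p b + q b) + r (σ M b)
    pointwise b = ≤-trans (+-mono-≤ (rows b) (links b)) (≤-reflexive (arrange₁ (pw b) _ (d (β b) (t b X)) (dx b) (r (σ M b))))
    arrange₂ : ∀ a b c e → ((a + b) + c) + e ≡ (a + (e + b)) + c
    arrange₂ = solve-∀
    charge : ∀ b → p b + q b + r b ≤ c b + q b
    charge b = ≤-trans (≤-reflexive (arrange₂ (d (β b) (t b X)) (pw b) (q b) (r b))) (+-monoˡ-≤ (q b) (minority≤c b))

  rows≤4 : ∑ D row ≤ 4
  rows≤4 = ≤-trans (m≤m+n _ _) uncrossed

  μ : Fin m → Bool
  μ u = maj₃ (λ i → β (u , i))

  dev : Dart m → ℕ
  dev b = d (β b) (μ (proj₁ b))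

  dev-row : 3 * ∑ D dev ≤ ∑ D row
  dev-row = begin
    3 * ∑ D dev                                                            ≡⟨ three (∑ D dev) ⟩
    ∑ D dev + (∑ D dev + ∑ D dev)                                         ≡⟨ cong (∑ D dev +_) (sym (∑-+ dev dev D)) ⟩
    ∑ D dev + ∑ D (λ b → dev b + dev b)                                   ≡⟨ sym (∑-+ dev (λ b → dev b + dev b) D) ⟩
    ∑ D (λ b → dev b + (dev b + dev b))                                   ≡⟨ ∑-cartesianProduct _ (allFin m) (allFin 3) ⟩
    ∑ (allFin m) (λ u → ∑ (allFin 3) (λ i → dev (u , i) + (dev (u , i) + dev (u , i))))
      ≤⟨ ∑-mono (allFin m) (λ u → ≤-trans (≤-reflexive (triple (λ i → dev (u , i)))) (K₃₃-cut (λ i → β (u , i)) (ζ u))) ⟩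
    ∑ (allFin m) (λ u → ∑ (allFin 3) (λ i → row (u , i)))                 ≡⟨ sym (∑-cartesianProduct row (allFin m) (allFin 3)) ⟩
    ∑ D row                                                                ∎
    where
    open ≤-Reasoning
    three : ∀ a → 3 * a ≡ a + (a + a)
    three = solve-∀
    triple : ∀ f → ∑ (allFin 3) (λ i → f i + (f i + f i)) ≡ 3 * ∑ (allFin 3) f
    triple f = trans (∑-+ f (λ i → f i + f i) (allFin 3)) (trans (cong (∑ (allFin 3) f +_) (∑-+ f f (allFin 3))) (sym (three (∑ (allFin 3) f))))

  g : Dart m → ℕ
  g b = d (μ (proj₁ b)) (μ (proj₁ (σ M b)))

  -- A difference of majorities along a dart is charged to its link and to the deviations of the two
  -- bricks. Each deviation is charged twice, within the three cut edges that `dev-row` grants it.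
  μ-cut : ∑ D g ≤ 4
  μ-cut = begin
    ∑ D g                                           ≤⟨ ∑-mono D pointwise ⟩
    ∑ D (λ b → (dev b + link b) + dev (σ M b))      ≡⟨ ∑-+ (λ b → dev b + link b) (dev ∘ σ M) D ⟩
    ∑ D (λ b → dev b + link b) + ∑ D (dev ∘ σ M)    ≤⟨ +-monoʳ-≤ _ (∑-σ M dev) ⟩
    ∑ D (λ b → dev b + link b) + ∑ D dev            ≡⟨ cong (_+ ∑ D dev) (∑-+ dev link D) ⟩
    ∑ D dev + ∑ D link + ∑ D dev                    ≤⟨ m≤m+n _ (∑ D dev) ⟩
    ∑ D dev + ∑ D link + ∑ D dev + ∑ D dev          ≡⟨ arrange (∑ D dev) (∑ D link) ⟩
    3 * ∑ D dev + ∑ D link                          ≤⟨ +-monoˡ-≤ _ dev-row ⟩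
    ∑ D row + ∑ D link                              ≤⟨ uncrossed ⟩
    4                                               ∎
    where
    open ≤-Reasoning
    arrange : ∀ a b → a + b + a + a ≡ 3 * a + b
    arrange = solve-∀
    pointwise : ∀ b → g b ≤ (dev b + link b) + dev (σ M b)
    pointwise b = ≤-trans (d-triangle (μ (proj₁ b)) (β (σ M b)) _)
      (+-monoˡ-≤ (dev (σ M b)) (≤-trans (d-triangle (μ (proj₁ b)) (β b) _)
        (+-monoˡ-≤ (link b) (≤-reflexive (d-sym (μ (proj₁ b)) (β b))))))

  down? : Decidable (λ (b : Dart m) → μ (proj₁ b) ≡ true × μ (proj₁ (σ M b)) ≡ false)
  down? b = (μ (proj₁ b) Bool.≟ true) ×-dec (μ (proj₁ (σ M b)) Bool.≟ false)

  F : List (Dart m)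
  F = filter down? D

  F⁻ : ∀ {b} → b ∈ F → μ (proj₁ b) ≡ true × μ (proj₁ (σ M b)) ≡ false
  F⁻ i = proj₂ (∈-filter⁻ down? {xs = D} i)

  -- `F` picks one dart of each cut edge of M, while `g` counts both, so three such edges would
  -- contribute six. Two is exactly what `ThreeEdgeConnected` tolerates.
  F-size : length F ≤ 2
  F-size with length F ≤? 2
  ... | yes p = p
  ... | no np = ⊥-elim (<⇒≱ {4} {6} (s≤s (s≤s (s≤s (s≤s (s≤s z≤n))))) (begin
      6                                  ≤⟨ +-mono-≤ (≰⇒> np) (≰⇒> np) ⟩
      length F + length F                ≡⟨ cong (length F +_) (sym (length-map (σ M) F)) ⟩
      length F + length (map (σ M) F)    ≡⟨ sym (length-++ F) ⟩
      length (F ++ map (σ M) F)          ≤⟨ ones g≥1 ⟩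
      ∑ (F ++ map (σ M) F) g             ≤⟨ ∑-⊆ g uniq (λ _ → ∈-darts _) ⟩
      ∑ D g                              ≤⟨ μ-cut ⟩
      4                                  ∎))
    where
    open ≤-Reasoning
    ones : ∀ {xs} → (∀ {b} → b ∈ xs → 1 ≤ g b) → length xs ≤ ∑ xs g
    ones {[]} h = z≤n
    ones {x ∷ xs} h = +-mono-≤ (h (here refl)) (ones (h ∘ there))
    g≥1 : ∀ {b} → b ∈ F ++ map (σ M) F → 1 ≤ g b
    g≥1 i with ∈-++⁻ F i
    ... | inj₁ j rewrite proj₁ (F⁻ j) | proj₂ (F⁻ j) = ≤-refl
    ... | inj₂ j with ∈-map⁻ (σ M) j
    ...   | b , k , refl rewrite invol M b | proj₁ (F⁻ k) | proj₂ (F⁻ k) = ≤-refl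
    uniq : Unique (F ++ map (σ M) F)
    uniq = Unique.++⁺ uF (Unique.map⁺ (σ-inj M) uF) disjoint
      where
      uF : Unique F
      uF = Unique.filter⁺ down? (darts-unique m)
      disjoint : ∀ {b} → ¬ (b ∈ F × b ∈ map (σ M) F)
      disjoint (i , j) with ∈-map⁻ (σ M) j
      ... | b , k , refl = true≢false (proj₁ (F⁻ i)) (proj₂ (F⁻ k))

  s : Bool
  s = μ u₀

  μ-const : ∀ u → μ u ≡ s
  μ-const u = go (conn F F-size u u₀)
    where
    F⁺ : ∀ b → μ (proj₁ b) ≡ true → μ (proj₁ (σ M b)) ≡ false → b ∈ F
    F⁺ b p q = ∈-filter⁺ down? (∈-darts b) (p , q)
    go : ∀ {u u′} → MConn M (λ b → b ∈ F ⊎ σ M b ∈ F) u u′ → μ u ≡ μ u′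
    go (here u) = refl
    go (step u i h rest) with go rest
    ... | r with μ u in p | μ (proj₁ (σ M (u , i))) in q
    ...   | true | true = r
    ...   | false | false = r
    ...   | true | false = ⊥-elim (h (inj₁ (F⁺ (u , i) p q)))
    ...   | false | true = ⊥-elim (h (inj₂ (F⁺ (σ M (u , i)) q (trans (cong (μ ∘ proj₁) (invol M (u , i))) p))))

  -- A deviating brick costs three edges to z-vertices. If its partner deviates as well, the cost is
  -- six; if not, both links between them are cut and the cost is five.
  β-const : ∀ b → β b ≡ s
  β-const b with β b Bool.≟ s
  ... | yes e = e
  ... | no ne = ⊥-elim (go (β (σ M b) Bool.≟ s))
    where
    dev1 : ∀ b → β b ≢ s → dev b ≡ 1
    dev1 b h = d-≢ (λ e → h (trans e (μ-const (proj₁ b))))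
    b≢σb : b ≢ σ M b
    b≢σb e = noFix M b (sym e)
    go : Dec (β (σ M b) ≡ s) → ⊥
    go (no ne′) = <⇒≱ {4} {6} (s≤s (s≤s (s≤s (s≤s (s≤s z≤n)))))
      (≤-trans (*-monoʳ-≤ 3 (subst (_≤ ∑ D dev) (cong₂ _+_ (dev1 b ne) (dev1 (σ M b) ne′)) (∑-∈₂ dev b≢σb (∈-darts _) (∈-darts _))))
        (≤-trans dev-row rows≤4))
    go (yes e) = <⇒≱ {4} {5} ≤-refl
      (≤-trans (+-mono-≤
        (≤-trans (*-monoʳ-≤ 3 (subst (_≤ ∑ D dev) (dev1 b ne) (∑-∈ dev (∈-darts b)))) dev-row)
        (subst (_≤ ∑ D link) (cong₂ _+_ (d-≢ cut) (d-≢ cut′)) (∑-∈₂ link b≢σb (∈-darts _) (∈-darts _))))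
      uncrossed)
      where
      cut : β b ≢ β (σ M b)
      cut q = ne (trans q e)
      cut′ : β (σ M b) ≢ β (σ M (σ M b))
      cut′ q = cut (sym (trans q (cong β (invol M b))))

  -- All bricks have majority `s`, so each exceptional z-vertex costs three edges, and two would
  -- cost six.
  ζ-one : ∀ u j u′ j′ → ζ u j ≢ s → ζ u′ j′ ≢ s → (u , j) ≡ (u′ , j′)
  ζ-one u j u′ j′ p q = go (u Fin.≟ u′) (j Fin.≟ j′)
    where
    f : Fin m → ℕ
    f u = ∑ (allFin 3) (λ j → d s (ζ u j))
    rowf : ∀ u i → row (u , i) ≡ f u
    rowf u i = cong (λ b → ∑ (allFin 3) (λ j → d b (ζ u j))) (β-const (u , i))
    tripled : ∑ (allFin m) (λ u → f u + (f u + (f u + 0))) ≤ 4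
    tripled = ≤-trans (∑-mono (allFin m) (λ u → ≤-reflexive (cong₂ _+_ (sym (rowf u zero))
        (cong₂ _+_ (sym (rowf u (suc zero))) (cong (_+ 0) (sym (rowf u (suc (suc zero)))))))))
      (≤-trans (≤-reflexive (sym (∑-cartesianProduct row (allFin m) (allFin 3)))) rows≤4)
    f≥1 : ∀ u j → ζ u j ≢ s → 1 ≤ f u
    f≥1 u j h = subst (_≤ f u) (d-≢ (h ∘ sym)) (∑-∈ (λ j → d s (ζ u j)) (∈-allFin j))
    3f : ∀ {k} u → k ≤ f u → k + (k + (k + 0)) ≤ f u + (f u + (f u + 0))
    3f u h = *-monoʳ-≤ 3 h
    six : ¬ (6 ≤ 4)
    six = <⇒≱ (s≤s (s≤s (s≤s (s≤s (s≤s z≤n)))))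
    go : Dec (u ≡ u′) → Dec (j ≡ j′) → (u , j) ≡ (u′ , j′)
    go (yes refl) (yes refl) = refl
    go (no ne) _ = ⊥-elim (six (≤-trans (+-mono-≤ (3f u (f≥1 u j p)) (3f u′ (f≥1 u′ j′ q)))
      (≤-trans (∑-∈₂ (λ u → f u + (f u + (f u + 0))) ne (∈-allFin u) (∈-allFin u′)) tripled)))
    go (yes refl) (no ne) = ⊥-elim (six (≤-trans (3f u (subst (_≤ f u) (cong₂ _+_ (d-≢ (p ∘ sym)) (d-≢ (q ∘ sym)))
      (∑-∈₂ (λ j → d s (ζ u j)) ne (∈-allFin j) (∈-allFin j′))))
      (≤-trans (∑-∈ (λ u → f u + (f u + (f u + 0))) (∈-allFin u)) tripled)))

-- Cyclic 5-connectivity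

-- Together with a dart, a slot names the place of an edge of T: within the brick, on the link at
-- its x-vertex, or from its `w j` to `z j`. Places are disjoint, so the counts at them add up to at
-- most the size of the cut.
data Slot : Set where
  inside link : Slot
  spoke : Fin 3 → Slot

spoke-injective : ∀ {i j} → spoke i ≡ spoke j → i ≡ j
spoke-injective refl = refl

_≟ˢ_ : (a b : Slot) → Dec (a ≡ b)
inside ≟ˢ inside = yes refl
inside ≟ˢ link = no λ ()
inside ≟ˢ spoke _ = no λ ()
link ≟ˢ inside = no λ ()
link ≟ˢ link = yes refl
link ≟ˢ spoke _ = no λ ()
spoke _ ≟ˢ inside = no λ ()
spoke _ ≟ˢ link = no λ ()
spoke i ≟ˢ spoke j = map′ (cong spoke) spoke-injective (i Fin.≟ j)

slots : List Slot
slots = inside ∷ link ∷ map spoke (allFin 3)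

slots-unique : Unique slots
slots-unique = ((λ ()) ∷ (λ ()) ∷ (λ ()) ∷ (λ ()) ∷ []) ∷ ((λ ()) ∷ (λ ()) ∷ (λ ()) ∷ []) ∷
  Unique.map⁺ spoke-injective (Unique.allFin⁺ 3)

length-filter-∑ : ∀ {A : Set} {P : A → Set} (P? : Decidable P) xs →
  length (filter P? xs) ≡ ∑ xs (λ a → if does (P? a) then 1 else 0)
length-filter-∑ P? [] = refl
length-filter-∑ P? (x ∷ xs) with P? x
... | yes _ = cong suc (length-filter-∑ P? xs)
... | no _ = length-filter-∑ P? xs

xor-true : ∀ {a b} → a ≢ b → a xor b ≡ true
xor-true {true} {true} h = ⊥-elim (h refl)
xor-true {true} {false} h = refl
xor-true {false} {true} h = refl
xor-true {false} {false} h = ⊥-elim (h refl)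

xor-true⁻ : ∀ {a b} → a xor b ≡ true → a ≢ b
xor-true⁻ {true} () refl
xor-true⁻ {false} () refl

xor-false⁻ : ∀ {a b} → a xor b ≡ false → a ≡ b
xor-false⁻ {true} {true} _ = refl
xor-false⁻ {false} {false} _ = refl

xor-d : ∀ a b → (if does (a xor b Bool.≟ true) then 1 else 0) ≡ d b a
xor-d true true = refl
xor-d true false = refl
xor-d false true = refl
xor-d false false = refl

module Regions {R : Set} (_≟_ : (r r′ : R) → Dec (r ≡ r′)) {A : Set} (tag : A → Maybe R) (C : List A) where

  tag? : ∀ r → Decidable (λ e → tag e ≡ just r)
  tag? r e = Maybe.≡-dec _≟_ (tag e) (just r)

  count : R → ℕ
  count r = length (filter (tag? r) C)

  private
    ind : R → A → ℕ
    ind r e = if does (tag? r e) then 1 else 0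

    once : ∀ e {rs} → Unique rs → ∑ rs (λ r → ind r e) ≤ 1
    once e {[]} u = z≤n
    once e {r ∷ rs} u@(_ ∷ u′) with tag? r e
    ... | no _ = once e u′
    ... | yes p = s≤s (≤-reflexive (zeros rs (λ i q → Unique.Unique[x∷xs]⇒x∉xs u (subst (_∈ rs) (Maybe.just-injective (trans (sym q) p)) i))))
      where
      zeros : ∀ rs → (∀ {r} → r ∈ rs → tag e ≢ just r) → ∑ rs (λ r → ind r e) ≡ 0
      zeros [] h = refl
      zeros (r ∷ rs) h with tag? r e
      ... | yes p = ⊥-elim (h (here refl) p)
      ... | no _ = zeros rs (h ∘ there)

    ∑-1 : ∀ (xs : List A) → ∑ xs (λ _ → 1) ≡ length xs
    ∑-1 [] = refl
    ∑-1 (x ∷ xs) = cong suc (∑-1 xs)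

  -- After exchanging the sums, each entry of `C` is counted at most once, at its own tag.
  count-total : ∀ {rs} → Unique rs → ∑ rs count ≤ length C
  count-total {rs} u = begin
    ∑ rs count                           ≤⟨ ∑-mono rs (λ r → ≤-reflexive (length-filter-∑ (tag? r) C)) ⟩
    ∑ rs (λ r → ∑ C (ind r))             ≡⟨ ∑-comm ind rs C ⟩
    ∑ C (λ e → ∑ rs (λ r → ind r e))     ≤⟨ ∑-mono C (λ e → once e u) ⟩
    ∑ C (λ _ → 1)                        ≡⟨ ∑-1 C ⟩
    length C                             ∎
    where open ≤-Reasoning

  count≥1 : ∀ {e r} → e ∈ C → tag e ≡ just r → 1 ≤ count r
  count≥1 {e} {r} i p with filter (tag? r) C | ∈-filter⁺ (tag? r) i p
  ... | _ ∷ _ | _ = s≤s z≤n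

-- The vertices and edges of T

module TGraph {n : ℕ} (E : Fin n → Fin n → Set) (sym-E : ∀ a b → E a b → E b a)
              (v : Fin n) (w : Fin 3 → Fin n) (x y : Fin n) {m : ℕ} (M : CubicMultigraph m) where

  open Construction E v w x y M public

  InB : Fin n → Set
  InB a = False (a Fin.≟ v)

  InB-irrelevant : ∀ {a} (p q : InB a) → p ≡ q
  InB-irrelevant = Bool.T-irrelevant

  at : Dart m → (a : Fin n) → InB a → TV
  at (u , i) = brk u i

  at-cong : ∀ b {a} {p q : InB a} → at b a p ≡ at b a q
  at-cong b {a} = cong (at b a) (InB-irrelevant _ _)

  triple-of : TV → Fin m
  triple-of (brk u _ _ _) = u
  triple-of (zv u _) = u

  _≟ᵀ_ : (s t : TV) → Dec (s ≡ t)
  brk u i a p ≟ᵀ brk u′ i′ a′ p′ with u Fin.≟ u′ | i Fin.≟ i′ | a Fin.≟ a′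
  ... | yes refl | yes refl | yes refl = yes (at-cong (u , i))
  ... | no h | _ | _ = no λ { refl → h refl }
  ... | yes _ | no h | _ = no λ { refl → h refl }
  ... | yes _ | yes _ | no h = no λ { refl → h refl }
  brk _ _ _ _ ≟ᵀ zv _ _ = no λ ()
  zv _ _ ≟ᵀ brk _ _ _ _ = no λ ()
  zv u j ≟ᵀ zv u′ j′ with u Fin.≟ u′ | j Fin.≟ j′
  ... | yes refl | yes refl = yes refl
  ... | no h | _ = no λ { refl → h refl }
  ... | yes _ | no h = no λ { refl → h refl }

  TAdj-sym : ∀ {s t} → TAdj s t → TAdj t s
  TAdj-sym (inBrick e h) = inBrick (sym-E _ _ e) (λ { (inj₁ (p , q)) → h (inj₂ (q , p)) ; (inj₂ (p , q)) → h (inj₁ (q , p)) })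
  TAdj-sym wz = zw
  TAdj-sym zw = wz
  TAdj-sym (linkxy {u} {i} e) = linkyx (trans (cong (σ M) (sym e)) (invol M (u , i)))
  TAdj-sym (linkyx {u} {i} e) = linkxy (trans (cong (σ M) (sym e)) (invol M (u , i)))

  ¬¬-∀TV : {P : TV → Set} → (∀ t → ¬ ¬ P t) → ¬ ¬ (∀ t → P t)
  ¬¬-∀TV {P} h k =
    ¬¬-∀Fin {P = λ u → ∀ i a p → P (brk u i a p)} (λ u → ¬¬-∀Fin λ i → ¬¬-∀Fin λ a → inB u i a (a Fin.≟ v)) λ b →
    ¬¬-∀Fin {P = λ u → ∀ j → P (zv u j)} (λ u → ¬¬-∀Fin λ j → h (zv u j)) λ z →
    k λ { (brk u i a p) → b u i a p ; (zv u j) → z u j }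
    where
    inB : ∀ u i a → Dec (a ≡ v) → ¬ ¬ (∀ p → P (brk u i a p))
    inB u i a (yes e) l = l (λ p → ⊥-elim (toWitnessFalse p e))
    inB u i a (no ne) l = h (brk u i a (fromWitnessFalse ne)) (λ q → l (λ p → subst P (at-cong (u , i)) q))

module Cuts {n : ℕ} (E : Fin n → Fin n → Set) (sym-E : ∀ a b → E a b → E b a)
            (irrefl-E : ∀ a → ¬ E a a) (cubic : Cubic (mkGraph (Fin n) E))
            (v : Fin n) (w : Fin 3 → Fin n) (w-inj : ∀ i j → w i ≡ w j → i ≡ j) (vw : ∀ j → E v (w j))
            (x y : Fin n) (xy : E x y)
            (far-x : Dist≥ (mkGraph (Fin n) E) 3 v x) (far-y : Dist≥ (mkGraph (Fin n) E) 3 v y)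
            (cyc4 : CyclicallyConnected 4 (mkGraph (Fin n) E))
            (cuts4 : ∀ (C : EdgeList (mkGraph (Fin n) E)) → length C ≡ 4 → DistinctEdges (mkGraph (Fin n) E) C →
                     IsCyclicEdgeCut (mkGraph (Fin n) E) C →
                     (∀ {a b} → (a , b) ∈ C → a ≢ v × b ≢ v × a ≢ x × b ≢ x)
                     × ¬ Connected (deleteEdges (mkGraph (Fin n) E) C) v x)
            {m : ℕ} (M : CubicMultigraph m) (conn : ThreeEdgeConnected M) where

  open Brick E sym-E irrefl-E cubic v w w-inj vw x y xy far-x far-y
  open TGraph E sym-E v w x y M

  coord : TV → Fin n
  coord (brk _ _ a _) = a
  coord (zv _ _) = v

  _≟ᴰ_ : (b b′ : Dart m) → Dec (b ≡ b′)
  _≟ᴰ_ = ≡-dec Fin._≟_ Fin._≟_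

  linkTag : ∀ {a} → Dart m → Dart m → Dec (a ≡ x) → Dart m × Slot
  linkTag b b′ (yes _) = b , link
  linkTag b b′ (no _) = b′ , link

  brickTag : ∀ {b b′ : Dart m} → Fin n → Dec (b ≡ b′) → Dart m × Slot
  brickTag {b} a (yes _) = b , inside
  brickTag {b} {b′} a (no _) = linkTag b b′ (a Fin.≟ x)

  -- The link joining the x-vertex of brick b to a y-vertex belongs to b.
  tag : TV × TV → Maybe (Dart m × Slot)
  tag (brk u i a _ , brk u′ i′ _ _) = just (brickTag a ((u , i) ≟ᴰ (u′ , i′)))
  tag (brk u i _ _ , zv _ j) = just ((u , i) , spoke j)
  tag (zv _ j , brk u i _ _) = just ((u , i) , spoke j)
  tag (zv _ _ , zv _ _) = nothing

  tag-inside : ∀ b {a a′ p q} → tag (at b a p , at b a′ q) ≡ just (b , inside)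
  tag-inside b {a} = cong just (lemma (b ≟ᴰ b))
    where
    lemma : ∀ (δ : Dec (b ≡ b)) → brickTag a δ ≡ (b , inside)
    lemma (yes _) = refl
    lemma (no h) = ⊥-elim (h refl)

  tag-link : ∀ {b b′ p q} → b ≢ b′ → tag (at b x p , at b′ y q) ≡ just (b , link)
  tag-link {b} {b′} ne = cong just (lemma (b ≟ᴰ b′) (x Fin.≟ x))
    where
    lemma : ∀ (δ : Dec (b ≡ b′)) (ε : Dec (x ≡ x)) → brickTag x δ ≡ (b , link)
    lemma (yes e) _ = ⊥-elim (ne e)
    lemma (no _) _ with x Fin.≟ x
    ... | yes _ = refl
    ... | no h = ⊥-elim (h refl)

  tag-link′ : ∀ {b b′ p q} → b ≢ b′ → tag (at b′ y q , at b x p) ≡ just (b , link)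
  tag-link′ {b} {b′} ne = cong just (lemma (b′ ≟ᴰ b))
    where
    lemma : ∀ (δ : Dec (b′ ≡ b)) → brickTag y δ ≡ (b , link)
    lemma (yes e) = ⊥-elim (ne (sym e))
    lemma (no _) with y Fin.≟ x
    ... | yes e = ⊥-elim (x≢y (sym e))
    ... | no _ = refl

  module Bipartition (C : List (TV × TV)) (C4 : length C ≤ 4) (A : TV → Bool)
                     (cover : ∀ {s t} → TAdj s t → A s ≢ A t → (s , t) ∈ C ⊎ (t , s) ∈ C) (u₀ : Fin m) where

    open Regions (≡-dec _≟ᴰ_ _≟ˢ_) tag C

    c dx : Dart m → ℕ
    c b = count (b , inside)
    dx b = count (b , link)

    dw : Dart m → Fin 3 → ℕ
    dw b j = count (b , spoke j)

    h : Dart m → ℕ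
    h b = c b + (dx b + ∑ (allFin 3) (dw b))

    total : ∑ (darts m) h ≤ 4
    total = ≤-trans (≤-reflexive (sym (∑-cartesianProduct count (darts m) slots)))
      (≤-trans (count-total (Unique.cartesianProduct⁺ (darts-unique m) slots-unique)) C4)

    cut≥1 : ∀ {s t r} → TAdj s t → tag (s , t) ≡ just r → tag (t , s) ≡ just r → d (A s) (A t) ≤ count r
    cut≥1 {s} {t} st p q with A s Bool.≟ A t
    ... | yes e = subst (_≤ _) (sym (trans (cong (d (A s)) (sym e)) (d-refl (A s)))) z≤n
      where
      d-refl : ∀ a → d a a ≡ 0
      d-refl true = refl
      d-refl false = refl
    ... | no ne = subst (_≤ _) (sym (d-≢ ne)) ([ (λ i → count≥1 i p) , (λ i → count≥1 i q) ]′ (cover st ne))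

    t : Dart m → Term → Bool
    t b τ = A (at b (tv τ) (tvB τ))

    ζ : Fin m → Fin 3 → Bool
    ζ u j = A (zv u j)

    dx≥ : ∀ b → d (t b X) (t (σ M b) Y) ≤ dx b
    dx≥ b = cut≥1 (linkxy refl) (tag-link {p = tvB X} {q = tvB Y} ne) (tag-link′ {p = tvB X} {q = tvB Y} ne)
      where
      ne : b ≢ σ M b
      ne e = noFix M b (sym e)

    dw≥ : ∀ b j → d (t b (W j)) (ζ (proj₁ b) j) ≤ dw b j
    dw≥ b j = cut≥1 wz refl refl

    -- The brick has no copy of `v`; it is put outside, as the lemmas on bricks require. Taking the
    -- decision as an argument lets the equations for `side` be proved by cases on it.
    sideAt : ∀ b (r : Bool) a → Dec (a ≡ v) → Bool
    sideAt b r a (yes _) = false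
    sideAt b r a (no ne) = A (at b a (fromWitnessFalse ne)) xor r

    -- The vertices of brick b that are not on side r.
    side : Dart m → Bool → Sub n
    side b r a = sideAt b r a (a Fin.≟ v)

    side-eq : ∀ b r a (p : InB a) → side b r a ≡ A (at b a p) xor r
    side-eq b r a p = go (a Fin.≟ v)
      where
      go : ∀ δ → sideAt b r a δ ≡ A (at b a p) xor r
      go (yes e) = ⊥-elim (toWitnessFalse p e)
      go (no ne) = cong (λ s → A s xor r) (at-cong b)

    side-v : ∀ b r → side b r v ≡ false
    side-v b r = go (v Fin.≟ v)
      where
      go : ∀ δ → sideAt b r v δ ≡ false
      go (yes _) = refl
      go (no ne) = ⊥-elim (ne refl)

    pairs : Dart m → List (Fin n × Fin n)
    pairs b = map (λ e → coord (proj₁ e) , coord (proj₂ e)) (filter (tag? (b , inside)) C)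

    pairs-length : ∀ b → length (pairs b) ≡ c b
    pairs-length b = length-map _ (filter (tag? (b , inside)) C)

    pairs-cover : ∀ b r → InnerCover (side b r) (pairs b)
    pairs-cover b r a a′ Sa Sa′ a≢v a′≢v aa′ ¬xy = Sum.map (λ i → ∈-map⁺ _ (∈-filter⁺ (tag? (b , inside)) i (tag-inside b {p = p} {q = q})))
      (λ i → ∈-map⁺ _ (∈-filter⁺ (tag? (b , inside)) i (tag-inside b {p = q} {q = p})))
      (cover (inBrick {p = p} {q = q} aa′ ¬xy) λ e → xor-true⁻ (trans (sym (side-eq b r a p)) Sa)
        (trans e (xor-false⁻ (trans (sym (side-eq b r a′ q)) Sa′))))
      where
      p : InB a
      p = fromWitnessFalse a≢v
      q : InB a′
      q = fromWitnessFalse a′≢v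

    side-terms : ∀ b r → length (termsIn (side b r)) ≡ ∑ terms (λ τ → d r (t b τ))
    side-terms b r = trans (length-filter-∑ (in? (side b r)) terms) (≤-antisym (∑-mono terms (≤-reflexive ∘ e)) (∑-mono terms (≤-reflexive ∘ sym ∘ e)))
      where
      e : ∀ τ → (if does (in? (side b r) τ) then 1 else 0) ≡ d r (t b τ)
      e τ = trans (cong (λ z → if does (z Bool.≟ true) then 1 else 0) (side-eq b r (tv τ) (tvB τ))) (xor-d (t b τ) r)

    few-terms-in : ∀ b → length (termsIn (side b (maj5 (t b)))) ≤ 2
    few-terms-in b = ≤-trans (≤-reflexive (side-terms b (maj5 (t b)))) (minority≤2 (t b))

    -- The part of the brick off the majority colour contains the minority terminals, hence is
    -- nonempty and holds at most two terminals.
    c≥2 : ∀ b → 1 ≤ minority (t b) → 2 ≤ c b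
    c≥2 b k1 with termsIn (side b r) in e | subst (1 ≤_) (sym (side-terms b r)) k1
      where
      r : Bool
      r = maj5 (t b)
    ... | τ ∷ _ | _ = subst (2 ≤_) (pairs-length b) (two-edge-connected cyc4 cuts4 (side b r) (pairs b) (side-v b r) (pairs-cover b r)
            (few-terms-in b) (tv τ) (∈-termsIn⁻ (side b r) (subst (τ ∈_) (sym e) (here refl))))
      where
      r : Bool
      r = maj5 (t b)

    open Counting M conn u₀ t ζ c dx dw total dx≥ dw≥ c≥2 using (s; β-const; ζ-one) public

    Off : TV → Set
    Off a = A a ≢ s

    off? : ∀ a → Dec (Off a)
    off? a = ¬? (A a Bool.≟ s)

    on : ∀ {a} → ¬ Off a → A a ≡ s
    on {a} h = decidable-stable (A a Bool.≟ s) h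

    off-side : ∀ b {a p} → Off (at b a p) → side b s a ≡ true
    off-side b {a} {p} o = trans (side-eq b s a p) (xor-true o)

    k2 : ∀ b → length (termsIn (side b s)) ≤ 2
    k2 b = subst (λ r → length (termsIn (side b r)) ≤ 2) (β-const b) (few-terms-in b)

    off-c : ∀ b {a p} → Off (at b a p) → 2 ≤ c b
    off-c b {a} o = subst (2 ≤_) (pairs-length b) (two-edge-connected cyc4 cuts4 (side b s) (pairs b) (side-v b s) (pairs-cover b s)
      (k2 b) a (off-side b o))

    off-h : ∀ b {a p} → Off (at b a p) → 2 ≤ h b
    off-h b o = ≤-trans (off-c b o) (m≤m+n _ _)

    one-off : ∀ b {a a′ p p′} → c b ≤ 2 → Off (at b a p) → Off (at b a′ p′) → a ≡ a′
    one-off b {a} {a′} cb o o′ = two-cut⇒≤1 cyc4 cuts4 (side b s) (pairs b) (side-v b s) (pairs-cover b s) (k2 b)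
      (≤-trans (≤-reflexive (pairs-length b)) cb) a a′ (off-side b o) (off-side b o′)

    -- In each brick of the triple, either the neighbour `w j` is off colour too, and the brick has
    -- inner cut edges, or the edge to it is cut.
    z-h : ∀ u j i → Off (zv u j) → 1 ≤ h (u , i)
    z-h u j i o with off? (at (u , i) (w j) (tvB (W j)))
    ... | yes o′ = ≤-trans (s≤s z≤n) (off-h (u , i) o′)
    ... | no ¬o′ = begin
        1                                     ≡⟨ sym (d-≢ (λ e → o (trans (sym e) (on ¬o′)))) ⟩
        d (t (u , i) (W j)) (ζ u j)           ≤⟨ dw≥ (u , i) j ⟩
        dw (u , i) j                          ≤⟨ ∑-∈ (dw (u , i)) (∈-allFin j) ⟩
        ∑ (allFin 3) (dw (u , i))             ≤⟨ m≤n+m _ (dx (u , i)) ⟩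
        dx (u , i) + ∑ (allFin 3) (dw (u , i)) ≤⟨ m≤n+m _ (c (u , i)) ⟩
        h (u , i)                             ∎
      where
      open ≤-Reasoning

    ∑-3 : ∀ {b₁ b₂ b₃} → b₁ ≢ b₂ → b₁ ≢ b₃ → b₂ ≢ b₃ → h b₁ + (h b₂ + h b₃) ≤ 4
    ∑-3 {b₁} {b₂} {b₃} p q r = ≤-trans (≤-reflexive (cong (λ z → h b₁ + (h b₂ + z)) (sym (+-identityʳ (h b₃)))))
      (≤-trans (∑-⊆ h {b₁ ∷ b₂ ∷ b₃ ∷ []} ((p ∷ q ∷ []) ∷ (r ∷ []) ∷ [] ∷ []) (λ _ → ∈-darts _)) total)

    too-many : ∀ k → ¬ (5 + k ≤ 4)
    too-many k (s≤s (s≤s (s≤s (s≤s ()))))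

    three-bricks : ∀ {b₁ b₂ b₃ a₁ a₂ a₃ p₁ p₂ p₃} → b₁ ≢ b₂ → b₁ ≢ b₃ → b₂ ≢ b₃ →
      Off (at b₁ a₁ p₁) → Off (at b₂ a₂ p₂) → Off (at b₃ a₃ p₃) → ⊥
    three-bricks {b₁} {b₂} {b₃} p q r o₁ o₂ o₃ =
      too-many 1 (≤-trans (+-mono-≤ (off-h b₁ o₁) (+-mono-≤ (off-h b₂ o₂) (off-h b₃ o₃))) (∑-3 p q r))

    -- The other brick takes two of the four cut edges; the two that may remain inside `b` separate
    -- only one vertex.
    two-and-brick : ∀ {b b′ a a′ a″ p p′ p″} → a ≢ a′ → b ≢ b′ →
      Off (at b a p) → Off (at b a′ p′) → Off (at b′ a″ p″) → ⊥
    two-and-brick {b} {b′} ne b≢b′ o o′ o″ = ne (one-off b cb o o′)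
      where
      cb : c b ≤ 2
      cb = +-cancelʳ-≤ 2 (c b) 2 (≤-trans (+-mono-≤ (m≤m+n (c b) _) (off-h b′ o″))
        (≤-trans (∑-∈₂ h b≢b′ (∈-darts b) (∈-darts b′)) total))

    off-third : ∀ (u : Fin m) (b b′ : Dart m) → ∃[ i ] ((u , i) ≢ b × (u , i) ≢ b′)
    off-third u (u₁ , i) (u₂ , i′) with avoid i i′
      where
      avoid : ∀ (i i′ : Fin 3) → ∃[ l ] (l ≢ i × l ≢ i′)
      avoid zero zero = suc zero , (λ ()) , (λ ())
      avoid zero (suc zero) = suc (suc zero) , (λ ()) , (λ ())
      avoid zero (suc (suc zero)) = suc zero , (λ ()) , (λ ())
      avoid (suc zero) zero = suc (suc zero) , (λ ()) , (λ ())
      avoid (suc zero) (suc i′) = zero , (λ ()) , (λ ())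
      avoid (suc (suc zero)) zero = suc zero , (λ ()) , (λ ())
      avoid (suc (suc zero)) (suc i′) = zero , (λ ()) , (λ ())
    ... | l , p , q = l , (λ { refl → p refl }) , (λ { refl → q refl })

    bricks-and-z : ∀ {b b′ a a′ p p′ u j} → b ≢ b′ → Off (at b a p) → Off (at b′ a′ p′) → Off (zv u j) → ⊥
    bricks-and-z {b} {b′} {u = u} {j} ne o o′ oz with off-third u b b′
    ... | i , p , q = too-many 0 (≤-trans (+-mono-≤ (z-h u j i oz) (+-mono-≤ (off-h b o) (off-h b′ o′))) (∑-3 p q ne))

    -- Two bricks of the triple of `u` differ from `b` and pay one edge each for the z-vertex,
    -- leaving at most two inside `b`.
    two-and-z : ∀ {b a a′ p p′ u j} → a ≢ a′ → Off (at b a p) → Off (at b a′ p′) → Off (zv u j) → ⊥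
    two-and-z {b} {u = u} {j} ne o o′ oz with off-third u b b
    ... | i , p , _ with off-third u b (u , i)
    ...   | i′ , q , r = ne (one-off b cb o o′)
      where
      cb : c b ≤ 2
      cb = +-cancelˡ-≤ 2 (c b) 2 (≤-trans (+-mono-≤ (z-h u j i oz) (+-mono-≤ (z-h u j i′ oz) (m≤m+n (c b) _)))
        (∑-3 (r ∘ sym) p q))

    -- By the previous cases the partner brick and the z-vertices are not off colour, so the outer
    -- edge of every off-colour terminal is cut. Inner cut edges and off-colour terminals then
    -- number at most four, as `sparse⇒≤2` demands.
    three-in-brick : ∀ {b a₁ a₂ a₃ p₁ p₂ p₃} → a₁ ≢ a₂ → a₁ ≢ a₃ → a₂ ≢ a₃ →
      Off (at b a₁ p₁) → Off (at b a₂ p₂) → Off (at b a₃ p₃) → ⊥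
    three-in-brick {b} {a₁} {a₂} {a₃} n₁₂ n₁₃ n₂₃ o₁ o₂ o₃ = <⇒≱ {2} {3} ≤-refl
      (sparse⇒≤2 cyc4 cuts4 (side b s) (pairs b) (side-v b s) (pairs-cover b s) (k2 b) c4
        (a₁ ∷ a₂ ∷ a₃ ∷ []) ((n₁₂ ∷ n₁₃ ∷ []) ∷ (n₂₃ ∷ []) ∷ [] ∷ [])
        λ { (here refl) → off-side b o₁ ; (there (here refl)) → off-side b o₂ ; (there (there (here refl))) → off-side b o₃ })
      where
      b≢σb : b ≢ σ M b
      b≢σb e = noFix M b (sym e)
      σb-on : ∀ τ → t (σ M b) τ ≡ s
      σb-on τ = on (two-and-brick n₁₂ b≢σb o₁ o₂)
      z-on : ∀ j → ζ (proj₁ b) j ≡ s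
      z-on j = on (two-and-z n₁₂ o₁ o₂)
      dX : d s (t b X) ≤ dx b
      dX = subst (_≤ dx b) (trans (cong (d (t b X)) (σb-on Y)) (d-sym (t b X) s)) (dx≥ b)
      dY : d s (t b Y) ≤ dx (σ M b)
      dY = subst (_≤ dx (σ M b)) (cong₂ d (σb-on X) (cong (λ b → t b Y) (invol M b))) (dx≥ (σ M b))
      dW : ∀ j → d s (t b (W j)) ≤ dw b j
      dW j = subst (_≤ dw b j) (trans (cong (d (t b (W j))) (z-on j)) (d-sym (t b (W j)) s)) (dw≥ b j)
      arrange : ∀ a e f g → a + (e + (f + g)) ≡ (a + (e + g)) + f
      arrange = solve-∀
      c4 : length (pairs b) + length (termsIn (side b s)) ≤ 4
      c4 = begin
        length (pairs b) + length (termsIn (side b s))         ≡⟨ cong₂ _+_ (pairs-length b) (side-terms b s) ⟩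
        c b + (d s (t b X) + (d s (t b Y) + ∑ (allFin 3) (λ j → d s (t b (W j)))))
          ≤⟨ +-monoʳ-≤ (c b) (+-mono-≤ dX (+-mono-≤ dY (∑-mono (allFin 3) dW))) ⟩
        c b + (dx b + (dx (σ M b) + ∑ (allFin 3) (dw b)))      ≡⟨ arrange (c b) (dx b) (dx (σ M b)) _ ⟩
        h b + dx (σ M b)                                       ≤⟨ +-monoʳ-≤ (h b) (≤-trans (m≤m+n _ _) (m≤n+m _ (c (σ M b)))) ⟩
        h b + h (σ M b)                                        ≤⟨ ∑-∈₂ h b≢σb (∈-darts b) (∈-darts (σ M b)) ⟩
        ∑ (darts m) h                                          ≤⟨ total ⟩
        4                                                      ∎
        where open ≤-Reasoning

    at-≢ : ∀ b {a a′ p p′} → at b a p ≢ at b a′ p′ → a ≢ a′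
    at-≢ b ne refl = ne (at-cong b)

    with-z : ∀ b b′ {a a′ p p′ u j} → at b a p ≢ at b′ a′ p′ → Off (at b a p) → Off (at b′ a′ p′) → Off (zv u j) → ⊥
    with-z b b′ ne o o′ oz with b ≟ᴰ b′
    ... | yes refl = two-and-z (at-≢ b ne) o o′ oz
    ... | no b≢b′ = bricks-and-z b≢b′ o o′ oz

    without-z : ∀ b₁ b₂ b₃ {a₁ a₂ a₃ p₁ p₂ p₃} → at b₁ a₁ p₁ ≢ at b₂ a₂ p₂ → at b₁ a₁ p₁ ≢ at b₃ a₃ p₃ →
      at b₂ a₂ p₂ ≢ at b₃ a₃ p₃ → Off (at b₁ a₁ p₁) → Off (at b₂ a₂ p₂) → Off (at b₃ a₃ p₃) → ⊥
    without-z b₁ b₂ b₃ n₁₂ n₁₃ n₂₃ o₁ o₂ o₃ with b₁ ≟ᴰ b₂ | b₁ ≟ᴰ b₃ | b₂ ≟ᴰ b₃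
    ... | yes refl | yes refl | _ = three-in-brick (at-≢ b₁ n₁₂) (at-≢ b₁ n₁₃) (at-≢ b₁ n₂₃) o₁ o₂ o₃
    ... | yes refl | no h | _ = two-and-brick (at-≢ b₁ n₁₂) h o₁ o₂ o₃
    ... | no h | yes refl | _ = two-and-brick (at-≢ b₁ n₁₃) h o₁ o₃ o₂
    ... | no h | no _ | yes refl = two-and-brick (at-≢ b₂ n₂₃) (h ∘ sym) o₂ o₃ o₁
    ... | no p | no q | no r = three-bricks p q r o₁ o₂ o₃

    -- Three is the least length of a cycle. At most one of the vertices is a z-vertex by `ζ-one`,
    -- which leaves the cases `with-z` and `without-z`.
    off-size : ∀ {t₁ t₂ t₃} → t₁ ≢ t₂ → t₁ ≢ t₃ → t₂ ≢ t₃ → Off t₁ → Off t₂ → Off t₃ → ⊥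
    off-size {brk u₁ i₁ _ _} {brk u₂ i₂ _ _} {brk u₃ i₃ _ _} = without-z (u₁ , i₁) (u₂ , i₂) (u₃ , i₃)
    off-size {zv _ _} {brk u i _ _} {brk u′ i′ _ _} n₁₂ n₁₃ n₂₃ o₁ o₂ o₃ = with-z (u , i) (u′ , i′) n₂₃ o₂ o₃ o₁
    off-size {brk u i _ _} {zv _ _} {brk u′ i′ _ _} n₁₂ n₁₃ n₂₃ o₁ o₂ o₃ = with-z (u , i) (u′ , i′) n₁₃ o₁ o₃ o₂
    off-size {brk u i _ _} {brk u′ i′ _ _} {zv _ _} n₁₂ n₁₃ n₂₃ o₁ o₂ o₃ = with-z (u , i) (u′ , i′) n₁₂ o₁ o₂ o₃
    off-size {zv u j} {zv u′ j′} n₁₂ n₁₃ n₂₃ o₁ o₂ o₃ = n₁₂ (cong (λ p → zv (proj₁ p) (proj₂ p)) (ζ-one u j u′ j′ o₁ o₂))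
    off-size {zv u j} {brk _ _ _ _} {zv u′ j′} n₁₂ n₁₃ n₂₃ o₁ o₂ o₃ = n₁₃ (cong (λ p → zv (proj₁ p) (proj₂ p)) (ζ-one u j u′ j′ o₁ o₃))
    off-size {brk _ _ _ _} {zv u j} {zv u′ j′} n₁₂ n₁₃ n₂₃ o₁ o₂ o₃ = n₂₃ (cong (λ p → zv (proj₁ p) (proj₂ p)) (ζ-one u j u′ j′ o₂ o₃))

    no-cycle-off : ∀ {Z} → IsCycle T Z → (∀ {a} → a ∈ Z → Off a) → ⊥
    no-cycle-off {a₁ ∷ a₂ ∷ a₃ ∷ _} (_ , (n₁₂ ∷ n₁₃ ∷ _) ∷ (n₂₃ ∷ _) ∷ _ , _) off =
      off-size n₁₂ n₁₃ n₂₃ (off (here refl)) (off (there (here refl))) (off (there (there (here refl))))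
    no-cycle-off {_ ∷ _ ∷ []} (s≤s () , _) off

  open DecMembership (≡-dec _≟ᵀ_ _≟ᵀ_) using () renaming (_∈?_ to _∈ᵀ?_)

  cycle-from : ∀ {C Z} → IsCycle (deleteEdges T C) Z → IsCycle T Z
  cycle-from {C} {_ ∷ _} (len , u , l) = len , u , Linked.map proj₁ l

  -- Colouring by reachability from `a` gives the two cycles different colours, so one of them is
  -- entirely off the prevailing colour `s`.
  cyclically-5-connected : CyclicallyConnected 5 T
  cyclically-5-connected C C<5 (_ , Z₁ , Z₂ , c₁ , c₂ , a , b , a∈ , b∈ , ¬con) =
    ¬¬-∀TV (λ t → ¬¬-excluded-middle {A = Connected (deleteEdges T C) a t}) go
    where
    go : (∀ t → Dec (Connected (deleteEdges T C) a t)) → ⊥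
    go reach? = sides s refl
      where
      A : TV → Bool
      A t = does (reach? t)
      A-true : ∀ {t} → Connected (deleteEdges T C) a t → A t ≡ true
      A-true {t} r with reach? t
      ... | yes _ = refl
      ... | no h = ⊥-elim (h r)
      A-false : ∀ {t} → ¬ Connected (deleteEdges T C) a t → A t ≡ false
      A-false {t} h with reach? t
      ... | yes r = ⊥-elim (h r)
      ... | no _ = refl
      del-sym : ∀ {s t} → Adj (deleteEdges T C) s t → Adj (deleteEdges T C) t s
      del-sym (st , p , q) = TAdj-sym st , q , p
      A-edge : ∀ {s t} → Adj (deleteEdges T C) s t → A s ≡ A t
      A-edge {s} {t} e with reach? s | reach? t
      ... | yes _ | yes _ = refl
      ... | no _ | no _ = refl
      ... | yes (_ , r) | no h = ⊥-elim (h (walk-snoc r e))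
      ... | no h | yes (_ , r) = ⊥-elim (h (walk-snoc r (del-sym e)))
      cover : ∀ {s t} → TAdj s t → A s ≢ A t → (s , t) ∈ C ⊎ (t , s) ∈ C
      cover {s} {t} st ne with (s , t) ∈ᵀ? C | (t , s) ∈ᵀ? C
      ... | yes i | _ = inj₁ i
      ... | no _ | yes i = inj₂ i
      ... | no i | no j = ⊥-elim (ne (A-edge (st , i , j)))
      -- The reference vertex of M is taken from `a`, as M is not assumed to have a vertex.
      open Bipartition C (≤-pred C<5) A cover (triple-of a)
      on-cycle : ∀ {Z t} → IsCycle (deleteEdges T C) Z → t ∈ Z → ∀ {z} → z ∈ Z → A z ≡ A t
      on-cycle {c ∷ rest} (_ , _ , l) t∈ z∈ = trans (linked-invariant A A-edge l (∈-++⁺ˡ z∈))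
        (sym (linked-invariant A A-edge l (∈-++⁺ˡ t∈)))
      sides : ∀ r → s ≡ r → ⊥
      sides true e = no-cycle-off (cycle-from c₂) λ i q →
        true≢false (trans q e) (trans (on-cycle c₂ b∈ i) (A-false ¬con))
      sides false e = no-cycle-off (cycle-from c₁) λ i q →
        true≢false (trans (on-cycle c₁ a∈ i) (A-true (0 , nil a))) (trans q e)

-- Hamiltonian cycles

module _ {A : Set} where

  linked-reverse : ∀ {R : A → A → Set} → (∀ a b → R a b → R b a) → ∀ {xs} → Linked R xs → Linked R (reverse xs)
  linked-reverse s [] = []
  linked-reverse s [-] = [-]
  linked-reverse {R} s {x ∷ y ∷ xs} (r ∷ l) = subst (Linked R) (sym e)
      (linked-join (reverse xs) (subst (Linked R) (unfold-reverse y xs) (linked-reverse s l)) (s _ _ r ∷ [-]))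
    where
    e : reverse (x ∷ y ∷ xs) ≡ reverse xs ++ y ∷ x ∷ []
    e = trans (unfold-reverse x (y ∷ xs)) (trans (cong (_++ x ∷ []) (unfold-reverse y xs)) (++-assoc (reverse xs) (y ∷ []) (x ∷ [])))

  data Consec (p q : A) : List A → Set where
    here  : ∀ {l} → Consec p q (p ∷ q ∷ l)
    there : ∀ {a l} → Consec p q l → Consec p q (a ∷ l)

  consec⁻ : ∀ {p q a c l} → Consec p q (a ∷ c ∷ l) → (a ≡ p × c ≡ q) ⊎ Consec p q (c ∷ l)
  consec⁻ here = inj₁ (refl , refl)
  consec⁻ (there h) = inj₂ h

  data Before (p q : A) : List A → Set where
    here  : ∀ {l} → q ∈ l → Before p q (p ∷ l)
    there : ∀ {a l} → Before p q l → Before p q (a ∷ l)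

  before-∈ʳ : ∀ {p q l} → Before p q l → q ∈ l
  before-∈ʳ (here i) = there i
  before-∈ʳ (there h) = there (before-∈ʳ h)

  before-asym : ∀ {p q l} → Unique l → Before p q l → Before q p l → ⊥
  before-asym u (here i) (here j) = Unique.Unique[x∷xs]⇒x∉xs u i
  before-asym u (here i) (there h) = Unique.Unique[x∷xs]⇒x∉xs u (before-∈ʳ h)
  before-asym u (there h) (here j) = Unique.Unique[x∷xs]⇒x∉xs u (before-∈ʳ h)
  before-asym (_ ∷ u) (there h) (there k) = before-asym u h k

  before-++ʳ : ∀ xs {p q l} → Before p q l → Before p q (xs ++ l)
  before-++ʳ [] h = h
  before-++ʳ (x ∷ xs) h = there (before-++ʳ xs h)

  consec-++ʳ : ∀ xs {p q l} → Consec p q l → Consec p q (xs ++ l)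
  consec-++ʳ [] h = h
  consec-++ʳ (x ∷ xs) h = there (consec-++ʳ xs h)

  unique-last : ∀ xs ys {z : A} {zs} → xs ++ z ∷ [] ≡ ys ++ z ∷ zs → Unique (xs ++ z ∷ []) → zs ≡ []
  unique-last [] [] refl u = refl
  unique-last (x ∷ xs) [] refl u = ⊥-elim (Unique.Unique[x∷xs]⇒x∉xs u (∈-++⁺ʳ xs (here refl)))
  unique-last [] (y ∷ []) () u
  unique-last [] (y ∷ _ ∷ ys) () u
  unique-last (x ∷ xs) (y ∷ ys) e (_ ∷ u) with ∷-injective e
  ... | refl , e′ = unique-last xs ys e′ u

-- Lets a tour begin at a z-vertex. Since that vertex lies in no brick, no passage through a brick
-- is broken by the start of the list.
rotate : ∀ {H : Graph} {cs z} → IsCycle H cs → z ∈ cs → ∃[ rest ] (IsCycle H (z ∷ rest) × (∀ {a} → a ∈ cs → a ∈ z ∷ rest))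
rotate {H} {cs} {z} cyc i with ∈-∃++ i
... | [] , post , refl = post , cyc , id
rotate {H} {.(c ∷ p ++ z ∷ post)} {z} (len , u , l) i | c ∷ p , post , refl =
  post ++ c ∷ p , (≤-trans len (≤-reflexive (cong pred (↭-length perm))) , Unique-↭ perm u , l′) , ∈-resp-↭ perm
  where
  perm : c ∷ p ++ z ∷ post ↭ z ∷ post ++ c ∷ p
  perm = ++-comm (c ∷ p) (z ∷ post)
  assoc : c ∷ (p ++ z ∷ post) ++ c ∷ [] ≡ (c ∷ p) ++ z ∷ (post ++ c ∷ [])
  assoc = cong (c ∷_) (++-assoc p (z ∷ post) (c ∷ []))
  l₁ : Linked (Adj H) ((c ∷ p) ++ z ∷ (post ++ c ∷ []))
  l₁ = subst (Linked (Adj H)) assoc l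
  l′ : Linked (Adj H) (z ∷ (post ++ c ∷ p) ++ z ∷ [])
  l′ = subst (Linked (Adj H)) (cong (z ∷_) (sym (++-assoc post (c ∷ p) (z ∷ []))))
    (linked-join (z ∷ post) (linked-++ʳ (c ∷ p) l₁) (linked-++ˡ (c ∷ p) l₁))

-- Covering a brick by segments between terminals

data XY : Term → Set where
  isX : XY X
  isY : XY Y

other : Term → Term
other X = Y
other Y = X
other (W j) = W j

isW : Term → Bool
isW (W _) = true
isW X = false
isW Y = false

module Segments {n : ℕ} (E : Fin n → Fin n → Set) (sym-E : ∀ a b → E a b → E b a)
             (irrefl-E : ∀ a → ¬ E a a) (cubic : Cubic (mkGraph (Fin n) E))
             (nonham : ¬ Hamiltonian (mkGraph (Fin n) E))
             (v : Fin n) (w : Fin 3 → Fin n) (w-inj : ∀ i j → w i ≡ w j → i ≡ j) (vw : ∀ j → E v (w j))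
             (x y : Fin n) (xy : E x y)
             (far-x : Dist≥ (mkGraph (Fin n) E) 3 v x) (far-y : Dist≥ (mkGraph (Fin n) E) 3 v y) where

  open Brick E sym-E irrefl-E cubic v w w-inj vw x y xy far-x far-y public

  -- Closing a segment off with the cut edges of G at its two terminals keeps it a walk of G.
  record IsSeg (σ : Term) (ps : List (Fin n)) (ε : Term) : Set where
    constructor isSeg
    field
      linked : Linked E (partner σ ∷ ps ++ partner ε ∷ [])
      first  : ∃[ qs ] ps ≡ tv σ ∷ qs
      final  : ∃[ qs ] ps ≡ qs ++ tv ε ∷ []

  seg-first∈ : ∀ {σ ps ε} → IsSeg σ ps ε → tv σ ∈ ps
  seg-first∈ s with IsSeg.first s
  ... | _ , refl = here refl

  seg-final∈ : ∀ {σ ps ε} → IsSeg σ ps ε → tv ε ∈ ps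
  seg-final∈ s with IsSeg.final s
  ... | qs , refl = ∈-++⁺ʳ qs (here refl)

  seg-reverse : ∀ {σ ps ε} → IsSeg σ ps ε → IsSeg ε (reverse ps) σ
  seg-reverse {σ} {ps} {ε} (isSeg l (qs , e) (rs , e′)) = isSeg
    (subst (Linked E) eq (linked-reverse sym-E l))
    (reverse rs , trans (cong reverse e′) (reverse-++ rs (tv ε ∷ [])))
    (reverse qs , trans (cong reverse e) (unfold-reverse (tv σ) qs))
    where
    eq : reverse (partner σ ∷ ps ++ partner ε ∷ []) ≡ partner ε ∷ reverse ps ++ partner σ ∷ []
    eq = trans (unfold-reverse (partner σ) (ps ++ partner ε ∷ [])) (cong (_++ partner σ ∷ []) (reverse-++ ps (partner ε ∷ [])))

  -- The two segments are bridged by the deleted edge xy, whose ends are each other's `partner`.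
  seg-join : ∀ {σ ps τ τ′ qs ε} → IsSeg σ ps τ → IsSeg τ′ qs ε → partner τ ≡ tv τ′ → IsSeg σ (ps ++ qs) ε
  seg-join {σ} {ps} {τ} {τ′} {_} {ε} (isSeg l (ps′ , refl) _) (isSeg l′ (qs′ , refl) (rs , e)) eq = isSeg
    (subst (λ z → Linked E (partner σ ∷ z)) (sym (++-assoc ps (tv τ′ ∷ qs′) (partner ε ∷ [])))
      (linked-join (partner σ ∷ ps) (subst (λ z → Linked E (partner σ ∷ ps ++ z ∷ [])) eq l) (Linked.tail l′)))
    (ps′ ++ tv τ′ ∷ qs′ , refl)
    (ps ++ rs , trans (cong (ps ++_) e) (sym (++-assoc ps rs (tv ε ∷ []))))

  Spanning : List (Fin n) → Set
  Spanning ps = Unique ps × (∀ {a} → a ∈ ps → a ≢ v) × (∀ {a} → a ≢ v → a ∈ ps)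

  spanning-↭ : ∀ {ps qs} → ps ↭ qs → Spanning ps → Spanning qs
  spanning-↭ p (u , f , g) = Unique-↭ p u , f ∘ ∈-resp-↭ (↭-sym p) , ∈-resp-↭ p ∘ g

  -- Adding `v` closes such a segment to a Hamiltonian cycle of G.
  no-spanning-ww : ∀ {i j ps} → IsSeg (W i) ps (W j) → Spanning ps → ⊥
  no-spanning-ww {ps = ps} s (u , ≢v , all) = nonham (v ∷ ps , (len , unique-∷ (λ i → ≢v i refl) u , IsSeg.linked s) , mem)
    where
    len : 2 ≤ length ps
    len = ≤-trans (n≤1+n 2) (unique-⊆-length {xs = map w (allFin 3)} {ys = ps}
      (Unique.map⁺ (λ {i} {j} → w-inj i j) (Unique.allFin⁺ 3)) sub)
      where
      sub : ∀ {a} → a ∈ map w (allFin 3) → a ∈ ps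
      sub i with ∈-map⁻ w i
      ... | j , _ , refl = all (tv≢v (W j))
    mem : ∀ a → a ∈ v ∷ ps
    mem a with a Fin.≟ v
    ... | yes e = here e
    ... | no ne = there (all ne)

  SegT : Set
  SegT = Term × List (Fin n) × Term

  start final : SegT → Term
  start (σ , _ , _) = σ
  final (_ , _ , ε) = ε

  Good : SegT → Set
  Good (σ , ps , ε) = IsSeg σ ps ε × σ ≢ ε

  bodies : List SegT → List (Fin n)
  bodies [] = []
  bodies ((_ , ps , _) ∷ ss) = ps ++ bodies ss

  ends : List SegT → List Term
  ends [] = []
  ends ((σ , _ , ε) ∷ ss) = σ ∷ ε ∷ ends ss

  wParity : List SegT → Bool
  wParity [] = false
  wParity ((σ , _ , ε) ∷ ss) = isW σ xor (isW ε xor wParity ss)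

  ends-∈ : ∀ {ss} → All Good ss → ∀ {τ} → τ ∈ ends ss → tv τ ∈ bodies ss
  ends-∈ ((s , _) ∷ gs) (here refl) = ∈-++⁺ˡ (seg-first∈ s)
  ends-∈ ((s , _) ∷ gs) (there (here refl)) = ∈-++⁺ˡ (seg-final∈ s)
  ends-∈ {(_ , ps , _) ∷ _} (g ∷ gs) (there (there i)) = ∈-++⁺ʳ ps (ends-∈ gs i)

  ends-unique : ∀ {ss} → All Good ss → Unique (bodies ss) → Unique (ends ss)
  ends-unique [] u = []
  ends-unique {(σ , ps , ε) ∷ ss} ((s , ne) ∷ gs) u =
    unique-∷ (λ { (here e) → ne e ; (there i) → unique-disjoint ps u (seg-first∈ s) (ends-∈ gs i) })
      (unique-∷ (λ i → unique-disjoint ps u (seg-final∈ s) (ends-∈ gs i)) (ends-unique gs (unique-++ʳ ps u)))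

  start∈ends : ∀ {s ss} → s ∈ ss → start s ∈ ends ss
  start∈ends (here refl) = here refl
  start∈ends (there i) = there (there (start∈ends i))

  final∈ends : ∀ {s ss} → s ∈ ss → final s ∈ ends ss
  final∈ends (here refl) = there (here refl)
  final∈ends (there i) = there (there (final∈ends i))

  start≢final : ∀ {s s′ ss} → Unique (ends ss) → s ∈ ss → s′ ∈ ss → start s ≢ final s′
  start≢final ((p ∷ _) ∷ _ ∷ u) (here refl) (here refl) e = p e
  start≢final ((_ ∷ p) ∷ _ ∷ u) (here refl) (there j) e = All.lookup p (final∈ends j) e
  start≢final (_ ∷ p ∷ u) (there i) (here refl) e = All.lookup p (start∈ends i) (sym e)
  start≢final (_ ∷ _ ∷ u) (there i) (there j) e = start≢final u i j e

  XYPair : Term → Term → Set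
  XYPair σ ε = (σ ≡ X × ε ≡ Y) ⊎ (σ ≡ Y × ε ≡ X)

  Full : SegT → Set
  Full (σ , _ , ε) = XYPair σ ε

  -- The types of segments up to direction; `half` also stores the segment turned so as to start at
  -- its w.
  data Kind : SegT → Set where
    ww   : ∀ {i j ps} → Kind (W i , ps , W j)
    half : ∀ {σ ps ε τ} i qs → XY τ → qs ↭ ps → IsSeg (W i) qs τ →
           (σ ≡ W i × ε ≡ τ) ⊎ (σ ≡ τ × ε ≡ W i) → Kind (σ , ps , ε)
    full : ∀ {s} → Full s → Kind s

  kind : ∀ s → Good s → Kind s
  kind (W i , ps , W j) _ = ww
  kind (W i , ps , X) (s , _) = half i ps isX ↭-refl s (inj₁ (refl , refl))
  kind (W i , ps , Y) (s , _) = half i ps isY ↭-refl s (inj₁ (refl , refl))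
  kind (X , ps , W i) (s , _) = half i (reverse ps) isX (↭-reverse ps) (seg-reverse s) (inj₂ (refl , refl))
  kind (Y , ps , W i) (s , _) = half i (reverse ps) isY (↭-reverse ps) (seg-reverse s) (inj₂ (refl , refl))
  kind (X , ps , X) (_ , ne) = ⊥-elim (ne refl)
  kind (Y , ps , Y) (_ , ne) = ⊥-elim (ne refl)
  kind (X , ps , Y) _ = full (inj₁ (refl , refl))
  kind (Y , ps , X) _ = full (inj₂ (refl , refl))

  half-parity : ∀ {σ ε τ i} → XY τ → (σ ≡ W i × ε ≡ τ) ⊎ (σ ≡ τ × ε ≡ W i) → ∀ r → isW σ xor (isW ε xor r) ≡ not r
  half-parity isX (inj₁ (refl , refl)) r = refl
  half-parity isX (inj₂ (refl , refl)) r = refl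
  half-parity isY (inj₁ (refl , refl)) r = refl
  half-parity isY (inj₂ (refl , refl)) r = refl

  half-avoids : ∀ {σ ε τ i} → XY τ → (σ ≡ W i × ε ≡ τ) ⊎ (σ ≡ τ × ε ≡ W i) → other τ ≢ σ × other τ ≢ ε
  half-avoids isX (inj₁ (refl , refl)) = (λ ()) , (λ ())
  half-avoids isX (inj₂ (refl , refl)) = (λ ()) , (λ ())
  half-avoids isY (inj₁ (refl , refl)) = (λ ()) , (λ ())
  half-avoids isY (inj₂ (refl , refl)) = (λ ()) , (λ ())

  half-end : ∀ {σ ε τ : Term} {i} → (σ ≡ W i × ε ≡ τ) ⊎ (σ ≡ τ × ε ≡ W i) → τ ∈ σ ∷ ε ∷ []
  half-end (inj₁ (_ , e)) = there (here (sym e))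
  half-end (inj₂ (e , _)) = here (sym e)

  other-XY : ∀ {τ} → XY τ → XY (other τ)
  other-XY isX = isY
  other-XY isY = isX

  other≢W : ∀ {τ i} → XY τ → other τ ≢ W i
  other≢W isX ()
  other≢W isY ()

  -- The parity excludes this case in a brick chosen to be even; the free terminal excludes it in
  -- the partner of a brick crossed from x to y, where both links are in use.
  Odd : List SegT → Set
  Odd ss = wParity ss ≡ true × ∃[ τ ] (XY τ × ¬ (τ ∈ ends ss))

  -- Two segments running from v's side to x and to y would close up, through the edge xy, to a Hamiltonian cycle.
  two-halves : ∀ {i j ps qs} → IsSeg (W i) ps X → IsSeg (W j) qs Y → Spanning (ps ++ qs) → ⊥
  two-halves {ps = ps} {qs} s s′ sp = no-spanning-ww (seg-join s (seg-reverse s′) refl)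
    (spanning-↭ (++⁺ (↭-refl {x = ps}) (↭-sym (↭-reverse qs))) sp)

  -- Three segments would need six terminals. Without a segment from x to y there remain one `half`,
  -- or one `half` with one `ww`, both odd: a lone `ww` and two halves to x and to y give
  -- Hamiltonian cycles of G, two `ww` need four w's, and two halves to the same terminal overlap.
  classify : ∀ ss → All Good ss → Spanning (bodies ss) → (∃[ s ] (s ∈ ss × Full s)) ⊎ Odd ss
  classify [] gs (_ , _ , all) with all (tv≢v X)
  ... | ()
  classify (s ∷ []) (g ∷ []) sp with kind s g
  ... | full f = inj₁ (s , here refl , f)
  ... | ww = ⊥-elim (no-spanning-ww (proj₁ g) (subst Spanning (++-identityʳ _) sp))
  ... | half i qs t p sg e = inj₂ (half-parity t e false , _ , other-XY t ,
          λ { (here r) → proj₁ (half-avoids t e) r ; (there (here r)) → proj₂ (half-avoids t e) r })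
  classify (s₁ ∷ s₂ ∷ []) (g₁ ∷ g₂ ∷ []) sp with kind s₁ g₁ | kind s₂ g₂ | ends-unique (g₁ ∷ g₂ ∷ []) (proj₁ sp)
  ... | full f | _ | _ = inj₁ (s₁ , here refl , f)
  ... | _ | full f | _ = inj₁ (s₂ , there (here refl) , f)
  ... | ww | half i qs t p sg e | _ = inj₂ (trans (Bool.not-involutive _) (half-parity t e false) , _ , other-XY t ,
          λ { (here r) → other≢W t r ; (there (here r)) → other≢W t r
            ; (there (there (here r))) → proj₁ (half-avoids t e) r ; (there (there (there (here r)))) → proj₂ (half-avoids t e) r })
  ... | half i qs t p sg e | ww | _ = inj₂ (half-parity t e false , _ , other-XY t ,
          λ { (here r) → proj₁ (half-avoids t e) r ; (there (here r)) → proj₂ (half-avoids t e) r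
            ; (there (there (here r))) → other≢W t r ; (there (there (there (here r)))) → other≢W t r })
  ... | ww {i₁} {j₁} | ww {i₂} {j₂} | u = ⊥-elim (<⇒≱ {3} {4} ≤-refl
          (unique-length-Fin {xs = i₁ ∷ j₁ ∷ i₂ ∷ j₂ ∷ []} (Unique.map⁻ {f = W} u)))
  ... | half i qs isX p sg e | half j rs isY q sg′ e′ | _ = ⊥-elim (two-halves sg sg′
          (spanning-↭ (++⁺ (↭-sym p) (↭-sym q)) (subst (λ z → Spanning (proj₁ (proj₂ s₁) ++ z)) (++-identityʳ _) sp)))
  ... | half i qs isY p sg e | half j rs isX q sg′ e′ | _ = ⊥-elim (two-halves sg′ sg
          (spanning-↭ (↭-trans (++-comm (proj₁ (proj₂ s₁)) (proj₁ (proj₂ s₂))) (++⁺ (↭-sym q) (↭-sym p)))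
            (subst (λ z → Spanning (proj₁ (proj₂ s₁) ++ z)) (++-identityʳ _) sp)))
  ... | half i qs isX p sg e | half j rs isX q sg′ e′ | u = ⊥-elim (unique-disjoint (start s₁ ∷ final s₁ ∷ []) u (half-end e) (half-end e′))
  ... | half i qs isY p sg e | half j rs isY q sg′ e′ | u = ⊥-elim (unique-disjoint (start s₁ ∷ final s₁ ∷ []) u (half-end e) (half-end e′))
  classify ss@(_ ∷ _ ∷ _ ∷ _) gs sp = ⊥-elim (<⇒≱ {5} {6} ≤-refl (≤-trans (s≤s (s≤s (s≤s (s≤s (s≤s (s≤s z≤n))))))
    (unique-⊆-length {xs = ends ss} {ys = terms} (ends-unique gs (proj₁ sp)) (λ _ → ∈-terms _))))

-- Tours of T and their passages through a brick

xor-interchange : ∀ a b c a′ b′ c′ → (a xor a′) xor ((b xor b′) xor (c xor c′)) ≡ (a xor (b xor c)) xor (a′ xor (b′ xor c′))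
xor-interchange a b c a′ b′ c′ = toEq (allVec-sound 6 check refl (a Vec.∷ b Vec.∷ c Vec.∷ a′ Vec.∷ b′ Vec.∷ c′ Vec.∷ Vec.[]))
  where
  check : Vec.Vec Bool 6 → Bool
  check (a Vec.∷ b Vec.∷ c Vec.∷ a′ Vec.∷ b′ Vec.∷ c′ Vec.∷ Vec.[]) =
    does ((a xor a′) xor ((b xor b′) xor (c xor c′)) Bool.≟ (a xor (b xor c)) xor (a′ xor (b′ xor c′)))
  toEq : ∀ {p q} → does (p Bool.≟ q) ≡ true → p ≡ q
  toEq {p} {q} e with p Bool.≟ q
  ... | yes r = r

xor-chain : ∀ a b c → (a xor b) xor (b xor c) ≡ a xor c
xor-chain true true c = refl
xor-chain true false c = refl
xor-chain false true true = refl
xor-chain false true false = refl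
xor-chain false false c = refl

module HamiltonianT {n : ℕ} (E : Fin n → Fin n → Set) (sym-E : ∀ a b → E a b → E b a)
             (irrefl-E : ∀ a → ¬ E a a) (cubic : Cubic (mkGraph (Fin n) E))
             (nonham : ¬ Hamiltonian (mkGraph (Fin n) E))
             (v : Fin n) (w : Fin 3 → Fin n) (w-inj : ∀ i j → w i ≡ w j → i ≡ j) (vw : ∀ j → E v (w j))
             (x y : Fin n) (xy : E x y)
             (far-x : Dist≥ (mkGraph (Fin n) E) 3 v x) (far-y : Dist≥ (mkGraph (Fin n) E) 3 v y)
             {m : ℕ} (M : CubicMultigraph m) where

  open Segments E sym-E irrefl-E cubic nonham v w w-inj vw x y xy far-x far-y
  open TGraph E sym-E v w x y M

  BV : Set
  BV = Σ (Fin n) InB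

  put : Dart m → BV → TV
  put b (a , p) = at b a p

  In : Dart m → TV → Set
  In b t = ∃[ α ] t ≡ put b α

  in-dart : ∀ {b b′ α α′} → put b α ≡ put b′ α′ → b ≡ b′
  in-dart refl = refl

  put-coord : ∀ {b α α′} → put b α ≡ put b α′ → proj₁ α ≡ proj₁ α′
  put-coord refl = refl

  term : Term → BV
  term τ = tv τ , tvB τ

  In? : ∀ b t → Dec (In b t)
  In? (u , i) (zv _ _) = no λ ()
  In? (u , i) (brk u′ i′ a p) with u Fin.≟ u′ | i Fin.≟ i′
  ... | yes refl | yes refl = yes ((a , p) , refl)
  ... | no h | _ = no λ { (_ , refl) → h refl }
  ... | yes _ | no h = no λ { (_ , refl) → h refl }

  outer-nb : Dart m → Term → TV
  outer-nb b (W j) = zv (proj₁ b) j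
  outer-nb b X = put (σ M b) (term Y)
  outer-nb b Y = put (σ M b) (term X)

  outer-nb-out : ∀ b τ → ¬ In b (outer-nb b τ)
  outer-nb-out b (W j) ()
  outer-nb-out b X (_ , e) = noFix M b (in-dart e)
  outer-nb-out b Y (_ , e) = noFix M b (in-dart e)

  leave : ∀ b {α t} → TAdj (put b α) t → ¬ In b t → ∃[ τ ] (proj₁ α ≡ tv τ × t ≡ outer-nb b τ)
  leave b (inBrick _ _) out = ⊥-elim (out (_ , refl))
  leave b (wz {j = j}) out = W j , refl , refl
  leave b (linkxy refl) out = X , refl , at-cong (σ M b)
  leave b (linkyx refl) out = Y , refl , at-cong (σ M b)

  stay : ∀ b {α α′} → TAdj (put b α) (put b α′) → E (proj₁ α) (proj₁ α′)
  stay b (inBrick e _) = e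
  stay b (linkxy e) = ⊥-elim (noFix M b e)
  stay b (linkyx e) = ⊥-elim (noFix M b e)

  partner-adj : ∀ τ → E (partner τ) (tv τ)
  partner-adj τ = sym-E _ _ (tv-partner τ)

  -- Cuts the walk `t ∷ l` where it enters or leaves brick `b`. The current vertex `t` always lies
  -- outside `b`; after a segment it is the vertex to which the walk has left.
  data Parse (b : Dart m) : TV → List TV → List SegT → Set where
    done : ∀ {t} → ¬ In b t → Parse b t [] []
    skip : ∀ {t t′ l ss} → ¬ In b t → Parse b t′ l ss → Parse b t (t′ ∷ l) ss
    seg  : ∀ {σ ε l ss} B → IsSeg σ (map proj₁ B) ε → Parse b (outer-nb b ε) l ss →
           Parse b (outer-nb b σ) (map (put b) B ++ outer-nb b ε ∷ l) ((σ , map proj₁ B , ε) ∷ ss)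

  EndsOutside : Dart m → TV → List TV → Set
  EndsOutside b t [] = ¬ In b t
  EndsOutside b t (t′ ∷ l) = EndsOutside b t′ l

  Inside : Dart m → BV → List TV → Set
  Inside b α l = ∃[ B ] ∃[ ε ] ∃[ l′ ] ∃[ ss ] (l ≡ map (put b) B ++ outer-nb b ε ∷ l′
    × Linked E (proj₁ α ∷ map proj₁ B ++ partner ε ∷ [])
    × (∃[ qs ] proj₁ α ∷ map proj₁ B ≡ qs ++ tv ε ∷ [])
    × Parse b (outer-nb b ε) l′ ss)

  parse : ∀ b t l → ¬ In b t → Linked TAdj (t ∷ l) → EndsOutside b t l → ∃[ ss ] Parse b t l ss
  parse-in : ∀ b α l → Linked TAdj (put b α ∷ l) → EndsOutside b (put b α) l → Inside b α l
  parse b t [] out _ _ = [] , done out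
  parse b t (t′ ∷ l) out (e ∷ lk) eo with In? b t′
  ... | no out′ with parse b t′ l out′ lk eo
  ...   | ss , p = ss , skip out p
  parse b t (t′ ∷ l) out (e ∷ lk) eo | yes (α , refl) with leave b (TAdj-sym e) out | parse-in b α l lk eo
  ... | σ , refl , refl | B , ε , l′ , ss , refl , lE , fin , p =
    _ , seg (α ∷ B) (isSeg (partner-adj σ ∷ lE) (_ , refl) fin) p
  parse-in b α [] lk eo = ⊥-elim (eo (α , refl))
  parse-in b α (t ∷ l) (e ∷ lk) eo with In? b t
  ... | yes (α′ , refl) with parse-in b α′ l lk eo
  ...   | B , ε , l′ , ss , refl , lE , (qs , fin) , p = α′ ∷ B , ε , l′ , ss , refl , stay b e ∷ lE , (proj₁ α ∷ qs , cong (proj₁ α ∷_) fin) , p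
  parse-in b α (t ∷ l) (e ∷ lk) eo | no out with leave b e out | parse b t l out lk eo
  ... | ε , refl , refl | ss , p = [] , ε , l , ss , refl , tv-partner ε ∷ [-] , ([] , refl) , p

  parse-out : ∀ {b t l ss} → Parse b t l ss → ¬ In b t
  parse-out (done out) = out
  parse-out (skip out _) = out
  parse-out {b} (seg {σ} _ _ _) = outer-nb-out b σ

  bodies-sound : ∀ {b t l ss a} → Parse b t l ss → a ∈ bodies ss → ∃[ p ] at b a p ∈ l
  bodies-sound (skip _ p) i with bodies-sound p i
  ... | q , j = q , there j
  bodies-sound {b} (seg B s p) i with ∈-++⁻ (map proj₁ B) i
  ... | inj₁ j with ∈-map⁻ proj₁ j
  ...   | (a , q) , k , refl = q , ∈-++⁺ˡ (∈-map⁺ (put b) k)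
  bodies-sound {b} (seg B s p) i | inj₂ j with bodies-sound p j
  ... | q , k = q , ∈-++⁺ʳ (map (put b) B) (there k)

  bodies-complete : ∀ {b t l ss a q} → Parse b t l ss → at b a q ∈ l → a ∈ bodies ss
  bodies-complete (skip _ p) (here refl) = ⊥-elim (parse-out p (_ , refl))
  bodies-complete (skip _ p) (there i) = bodies-complete p i
  bodies-complete {b} (seg {ε = ε} B s p) i with ∈-++⁻ (map (put b) B) i
  ... | inj₁ j with ∈-map⁻ (put b) j
  ...   | α , k , refl = ∈-++⁺ˡ (∈-map⁺ proj₁ k)
  bodies-complete {b} (seg {ε = ε} B s p) i | inj₂ (here e) = ⊥-elim (outer-nb-out b ε (_ , sym e))
  bodies-complete {b} (seg B s p) i | inj₂ (there k) = ∈-++⁺ʳ (map proj₁ B) (bodies-complete p k)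

  bodies-unique : ∀ {b t l ss} → Parse b t l ss → Unique l → Unique (bodies ss)
  bodies-unique (done _) u = []
  bodies-unique (skip _ p) (_ ∷ u) = bodies-unique p u
  bodies-unique {b} (seg {ε = ε} {l} {ss} B s p) u = Unique.++⁺ uB (bodies-unique p (unique-++ʳ (_ ∷ []) (unique-++ʳ (map (put b) B) u)))
      λ { (i , j) → disjoint i j }
    where
    uB : Unique (map proj₁ B)
    uB = go B (unique-++ˡ (map (put b) B) u)
      where
      go : ∀ B → Unique (map (put b) B) → Unique (map proj₁ B)
      go [] u = []
      go (α ∷ B) u@(_ ∷ u′) = unique-∷ fresh (go B u′)
        where
        fresh : ¬ (proj₁ α ∈ map proj₁ B)
        fresh i with ∈-map⁻ proj₁ i
        ... | α′ , k , refl = Unique.Unique[x∷xs]⇒x∉xs u (subst (_∈ map (put b) B) (at-cong b) (∈-map⁺ (put b) k))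
    disjoint : ∀ {a} → a ∈ map proj₁ B → a ∈ bodies ss → ⊥
    disjoint i j with ∈-map⁻ proj₁ i | bodies-sound p j
    ... | (a , q) , k , refl | q′ , k′ = unique-disjoint (map (put b) B) u (∈-map⁺ (put b) k)
            (there (subst (_∈ l) (at-cong b) k′))

  nonempty : ∀ {σ ε b} B → IsSeg σ (map proj₁ B) ε → ∃[ B′ ] (map (put b) B ≡ put b (term σ) ∷ B′)
  nonempty [] s with IsSeg.first s
  ... | _ , ()
  nonempty {b = b} (α ∷ B) s with IsSeg.first s
  ... | _ , refl = _ , cong (_∷ map (put b) B) (at-cong b)

  ends-last : ∀ {σ ε b} B → IsSeg σ (map proj₁ B) ε → ∃[ B′ ] (map (put b) B ≡ B′ ++ put b (term ε) ∷ [])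
  ends-last {ε = ε} {b} B s = go B (IsSeg.final s)
    where
    go : ∀ B → ∃[ qs ] map proj₁ B ≡ qs ++ tv ε ∷ [] → ∃[ B′ ] (map (put b) B ≡ B′ ++ put b (term ε) ∷ [])
    go [] ([] , ())
    go [] (_ ∷ _ , ())
    go (α ∷ []) ([] , refl) = [] , cong (_∷ []) (at-cong b)
    go (α ∷ _ ∷ B) ([] , ())
    go (α ∷ B) (q ∷ qs , e) with go B (qs , cong (drop 1) e)
    ... | B′ , e′ = put b α ∷ B′ , cong (put b α ∷_) e′

  -- A one-vertex segment would be entered from and left to the same vertex outside the brick.
  starts≢ends : ∀ {b t l ss} → Parse b t l ss → Unique (t ∷ l) → All Good ss
  starts≢ends (done _) u = []
  starts≢ends (skip _ p) (_ ∷ u) = starts≢ends p u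
  starts≢ends {b} (seg B s p) u = (s , λ { refl → Unique.Unique[x∷xs]⇒x∉xs u (∈-++⁺ʳ (map (put b) B) (here refl)) })
    ∷ starts≢ends p (unique-++ʳ (outer-nb b _ ∷ map (put b) B) u)

  enters : ∀ {b t l ss s} → Parse b t l ss → s ∈ ss → Consec (outer-nb b (start s)) (put b (term (start s))) (t ∷ l)
  enters (skip _ p) i = there (enters p i)
  enters {b} (seg {σ} {ε} {l} B s p) (here refl) with nonempty {b = b} B s
  ... | _ , e = subst (λ B → Consec (outer-nb b σ) (put b (term σ)) (outer-nb b σ ∷ B ++ outer-nb b ε ∷ l)) (sym e) here
  enters {b} (seg B s p) (there i) = there (consec-++ʳ (map (put b) B) (enters p i))

  exits : ∀ {b t l ss s} → Parse b t l ss → s ∈ ss → Consec (put b (term (final s))) (outer-nb b (final s)) (t ∷ l)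
  exits (skip _ p) i = there (exits p i)
  exits {b} (seg {σ} {ε} {l} B s p) (here refl) with ends-last {b = b} B s
  ... | B′ , e = there (subst (λ B → Consec (put b (term ε)) (outer-nb b ε) (B ++ outer-nb b ε ∷ l)) (sym e)
    (subst (Consec _ _) (sym (++-assoc B′ _ _)) (consec-++ʳ B′ here)))
  exits {b} (seg B s p) (there i) = there (consec-++ʳ (map (put b) B) (exits p i))

  passes : ∀ {b t l ss s} → Parse b t l ss → s ∈ ss → Before (outer-nb b (start s)) (outer-nb b (final s)) (t ∷ l)
  passes (skip _ p) i = there (passes p i)
  passes {b} (seg B s p) (here refl) = here (∈-++⁺ʳ (map (put b) B) (here refl))
  passes {b} (seg B s p) (there i) = there (before-++ʳ (map (put b) B) (passes p i))

  traverses : ∀ {b t l ss s} → Parse b t l ss → s ∈ ss → start s ≢ final s →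
    Before (put b (term (start s))) (put b (term (final s))) l
  traverses (skip _ p) i ne = there (traverses p i ne)
  traverses {b} (seg {σ} {ε} {l} B s p) (here refl) ne with nonempty {b = b} B s | ends-last {b = b} B s
  ... | B′ , e | B″ , e″ with B″ | trans (sym e) e″
  ...   | [] | e₃ = ⊥-elim (ne (tv-inj (put-coord {b} (∷-injectiveˡ e₃))))
  ...   | q ∷ qs | refl = subst (λ B → Before (put b (term σ)) (put b (term ε)) (B ++ outer-nb b ε ∷ l)) (sym e)
            (here (∈-++⁺ˡ (∈-++⁺ʳ qs (here refl))))
  traverses {b} (seg B s p) (there i) ne = before-++ʳ (map (put b) B) (there (traverses p i ne))

  -- A converse of `enters`: a step into `b` from outside can only be the beginning of a segment.
  found-start : ∀ {b t l ss s α} → Parse b t l ss → ¬ In b s → Consec s (put b α) (t ∷ l) → ∃[ g ] (g ∈ ss × tv (start g) ≡ proj₁ α)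
  found-start (done _) out (there ())
  found-start (skip _ p) out c with consec⁻ c
  ... | inj₁ (_ , refl) = ⊥-elim (parse-out p (_ , refl))
  ... | inj₂ c′ = found-start p out c′
  found-start {b} {s = s} {α} (seg {σ} {ε} {l} {ss} B sg p) out c = enter B (IsSeg.first sg) c
    where
    Result : Set
    Result = ∃[ g ] (g ∈ (σ , map proj₁ B , ε) ∷ ss × tv (start g) ≡ proj₁ α)
    later : Consec s (put b α) (outer-nb b ε ∷ l) → Result
    later c with found-start p out c
    ... | g , i , q = g , there i , q
    inner : ∀ β B′ → Consec s (put b α) (put b β ∷ map (put b) B′ ++ outer-nb b ε ∷ l) → Result
    inner β [] c with consec⁻ c
    ... | inj₁ (e , _) = ⊥-elim (out (_ , sym e))
    ... | inj₂ c′ = later c′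
    inner β (γ ∷ B′) c with consec⁻ c
    ... | inj₁ (e , _) = ⊥-elim (out (_ , sym e))
    ... | inj₂ c′ = inner γ B′ c′
    enter : ∀ B′ → ∃[ qs ] map proj₁ B′ ≡ tv σ ∷ qs → Consec s (put b α) (outer-nb b σ ∷ map (put b) B′ ++ outer-nb b ε ∷ l) → Result
    enter [] (_ , ())
    enter (β ∷ B′) (_ , e) c with consec⁻ c
    ... | inj₁ (_ , q) = _ , here refl , trans (sym (∷-injectiveˡ e)) (put-coord {b} q)
    ... | inj₂ c′ = inner β B′ c′

  found-final : ∀ {b t l ss s α} → Parse b t l ss → ¬ In b s → Consec (put b α) s (t ∷ l) → ∃[ g ] (g ∈ ss × tv (final g) ≡ proj₁ α)
  found-final (done _) out (there ())
  found-final (skip o p) out c with consec⁻ c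
  ... | inj₁ (refl , _) = ⊥-elim (o (_ , refl))
  ... | inj₂ c′ = found-final p out c′
  found-final {b} {s = s} {α} (seg {σ} {ε} {l} {ss} B sg p) out c = enter B (IsSeg.first sg) (IsSeg.final sg) c
    where
    Result : Set
    Result = ∃[ g ] (g ∈ (σ , map proj₁ B , ε) ∷ ss × tv (final g) ≡ proj₁ α)
    later : Consec (put b α) s (outer-nb b ε ∷ l) → Result
    later c with found-final p out c
    ... | g , i , q = g , there i , q
    single : ∀ {a a′ : Fin n} qs → a ∷ [] ≡ qs ++ a′ ∷ [] → a ≡ a′
    single [] refl = refl
    single (_ ∷ []) ()
    single (_ ∷ _ ∷ _) ()
    shorter : ∀ {a c a′ : Fin n} {as} qs → a ∷ c ∷ as ≡ qs ++ a′ ∷ [] → ∃[ qs′ ] c ∷ as ≡ qs′ ++ a′ ∷ []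
    shorter [] ()
    shorter (_ ∷ qs) e = qs , cong (drop 1) e
    inner : ∀ β B′ → ∃[ qs ] proj₁ β ∷ map proj₁ B′ ≡ qs ++ tv ε ∷ [] → Consec (put b α) s (put b β ∷ map (put b) B′ ++ outer-nb b ε ∷ l) → Result
    inner β [] (qs , f) c with consec⁻ c
    ... | inj₁ (e , _) = _ , here refl , trans (sym (single qs f)) (put-coord {b} e)
    ... | inj₂ c′ = later c′
    inner β (γ ∷ B′) (qs , f) c with consec⁻ c
    ... | inj₁ (_ , e) = ⊥-elim (out (_ , sym e))
    ... | inj₂ c′ = inner γ B′ (shorter qs f) c′
    enter : ∀ B′ → ∃[ qs ] map proj₁ B′ ≡ tv σ ∷ qs → ∃[ qs ] map proj₁ B′ ≡ qs ++ tv ε ∷ [] →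
      Consec (put b α) s (outer-nb b σ ∷ map (put b) B′ ++ outer-nb b ε ∷ l) → Result
    enter [] (_ , ()) _ _
    enter (β ∷ B′) _ f c with consec⁻ c
    ... | inj₁ (e , _) = ⊥-elim (outer-nb-out b σ (_ , e))
    ... | inj₂ c′ = inner β B′ f c′

  inᵇ : Dart m → TV → Bool
  inᵇ (u , i) (brk u′ i′ _ _) = does (u′ Fin.≟ u) ∧ does (i′ Fin.≟ i)
  inᵇ _ (zv _ _) = false

  zᵇ : Fin m → TV → Bool
  zᵇ u (brk _ _ _ _) = false
  zᵇ u (zv u′ _) = does (u′ Fin.≟ u)

  does-refl : ∀ {k} (a : Fin k) → does (a Fin.≟ a) ≡ true
  does-refl a with a Fin.≟ a
  ... | yes _ = refl
  ... | no h = ⊥-elim (h refl)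

  inᵇ-put : ∀ b α → inᵇ b (put b α) ≡ true
  inᵇ-put (u , i) α rewrite does-refl u | does-refl i = refl

  inᵇ-out : ∀ b {t} → ¬ In b t → inᵇ b t ≡ false
  inᵇ-out (u , i) {zv _ _} out = refl
  inᵇ-out (u , i) {brk u′ i′ a p} out with u′ Fin.≟ u | i′ Fin.≟ i
  ... | no _ | _ = refl
  ... | yes _ | no _ = refl
  ... | yes refl | yes refl = ⊥-elim (out (_ , refl))

  -- Recognises a step, in either direction, between `b` and a z-vertex of its own triple. Boolean
  -- values suffice because only the parity of their number matters.
  wz-step : Dart m → TV → TV → Bool
  wz-step b s t = (zᵇ (proj₁ b) s ∧ inᵇ b t) xor (inᵇ b s ∧ zᵇ (proj₁ b) t)

  wz-parity : Dart m → TV → List TV → Bool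
  wz-parity b t [] = false
  wz-parity b t (t′ ∷ l) = wz-step b t t′ xor wz-parity b t′ l

  zᵇ-outer : ∀ b τ → zᵇ (proj₁ b) (outer-nb b τ) ≡ isW τ
  zᵇ-outer b (W j) = does-refl (proj₁ b)
  zᵇ-outer b X = refl
  zᵇ-outer b Y = refl

  step-in : ∀ b τ α → wz-step b (outer-nb b τ) (put b α) ≡ isW τ
  step-in b τ α rewrite zᵇ-outer b τ | inᵇ-put b α | inᵇ-out b (outer-nb-out b τ) = lemma (isW τ)
    where
    lemma : ∀ a → (a ∧ true) xor false ≡ a
    lemma true = refl
    lemma false = refl

  step-out : ∀ b τ α → wz-step b (put b α) (outer-nb b τ) ≡ isW τ
  step-out b τ α rewrite zᵇ-outer b τ | inᵇ-put b α = refl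

  step-outside : ∀ b {s t} → ¬ In b s → ¬ In b t → wz-step b s t ≡ false
  step-outside b {s} p q rewrite inᵇ-out b p | inᵇ-out b q = lemma (zᵇ (proj₁ b) s)
    where
    lemma : ∀ a → (a ∧ false) xor false ≡ false
    lemma true = refl
    lemma false = refl

  step-inside : ∀ b α α′ → wz-step b (put b α) (put b α′) ≡ false
  step-inside b α α′ rewrite inᵇ-put b α = refl

  -- Steps between `b` and its z-vertices are exactly those by which a segment begins or ends at a
  -- w.
  parse-parity : ∀ {b t l ss} → Parse b t l ss → wz-parity b t l ≡ wParity ss
  parse-parity (done _) = refl
  parse-parity {b} (skip out p) rewrite step-outside b out (parse-out p) = parse-parity p
  parse-parity {b} (seg {σ} {ε} {l} {ss} B s p) = go B (IsSeg.first s)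
    where
    inside-parity : ∀ α B → wz-parity b (put b α) (map (put b) B ++ outer-nb b ε ∷ l) ≡ isW ε xor wParity ss
    inside-parity α [] = cong₂ _xor_ (step-out b ε α) (parse-parity p)
    inside-parity α (β ∷ B) rewrite step-inside b α β = inside-parity β B
    go : ∀ B → ∃[ qs ] map proj₁ B ≡ tv σ ∷ qs → wz-parity b (outer-nb b σ) (map (put b) B ++ outer-nb b ε ∷ l) ≡ isW σ xor (isW ε xor wParity ss)
    go [] (_ , ())
    go (α ∷ B) _ = cong₂ _xor_ (step-in b σ α) (inside-parity α B)

  i₀ i₁ i₂ : Fin 3
  i₀ = zero
  i₁ = suc zero
  i₂ = suc (suc zero)

  -- The three indicators together detect a step between the z-vertices of the triple and all other
  -- vertices. As a difference of end values this telescopes along a walk and vanishes on a closed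
  -- one.
  triple-step : ∀ u {s t} → TAdj s t →
    wz-step (u , i₀) s t xor (wz-step (u , i₁) s t xor wz-step (u , i₂) s t) ≡ zᵇ u s xor zᵇ u t
  triple-step u {brk u₁ j₁ a p} {brk _ _ _ _} _ = zeros (inᵇ (u , i₀) (brk u₁ j₁ a p)) (inᵇ (u , i₁) (brk u₁ j₁ a p)) (inᵇ (u , i₂) (brk u₁ j₁ a p))
    where
    zeros : ∀ a b c → (a ∧ false) xor ((b ∧ false) xor (c ∧ false)) ≡ false
    zeros a b c rewrite Bool.∧-zeroʳ a | Bool.∧-zeroʳ b | Bool.∧-zeroʳ c = refl
  triple-step u (wz {u′} {i}) = lemma (does (u′ Fin.≟ u)) i
    where
    lemma : ∀ a i → ((a ∧ does (i Fin.≟ i₀)) ∧ a) xor (((a ∧ does (i Fin.≟ i₁)) ∧ a) xor ((a ∧ does (i Fin.≟ i₂)) ∧ a)) ≡ a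
    lemma true zero = refl
    lemma true (suc zero) = refl
    lemma true (suc (suc zero)) = refl
    lemma false zero = refl
    lemma false (suc zero) = refl
    lemma false (suc (suc zero)) = refl
  triple-step u (zw {u′} {i}) = lemma (does (u′ Fin.≟ u)) i
    where
    lemma : ∀ a i → ((a ∧ (a ∧ does (i Fin.≟ i₀))) xor false) xor (((a ∧ (a ∧ does (i Fin.≟ i₁))) xor false) xor ((a ∧ (a ∧ does (i Fin.≟ i₂))) xor false)) ≡ a xor false
    lemma true zero = refl
    lemma true (suc zero) = refl
    lemma true (suc (suc zero)) = refl
    lemma false zero = refl
    lemma false (suc zero) = refl
    lemma false (suc (suc zero)) = refl

  -- Every edge at a z-vertex of the triple of u leads to one of its three bricks.
  triple-parity : ∀ u t l z → Linked TAdj (t ∷ l ++ z ∷ []) →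
    wz-parity (u , i₀) t (l ++ z ∷ []) xor (wz-parity (u , i₁) t (l ++ z ∷ []) xor wz-parity (u , i₂) t (l ++ z ∷ [])) ≡ zᵇ u t xor zᵇ u z
  triple-parity u t [] z (e ∷ [-]) = trans (xor-interchange (s i₀) (s i₁) (s i₂) false false false)
      (trans (Bool.xor-identityʳ _) (triple-step u e))
    where
    s : Fin 3 → Bool
    s i = wz-step (u , i) t z
  triple-parity u t (t′ ∷ l) z (e ∷ lk) = trans (xor-interchange (s i₀) (s i₁) (s i₂) (r i₀) (r i₁) (r i₂))
      (trans (cong₂ _xor_ (triple-step u e) (triple-parity u t′ l z lk)) (xor-chain (zᵇ u t) (zᵇ u t′) (zᵇ u z)))
    where
    s r : Fin 3 → Bool
    s i = wz-step (u , i) t t′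
    r i = wz-parity (u , i) t′ (l ++ z ∷ [])

  even-brick : ∀ (f : Fin 3 → Bool) → f i₀ xor (f i₁ xor f i₂) ≡ false → ∃[ i ] f i ≡ false
  even-brick f e with f i₀ in e₀ | f i₁ in e₁ | f i₂ in e₂
  ... | false | _ | _ = i₀ , e₀
  ... | true | false | _ = i₁ , e₁
  ... | true | true | false = i₂ , e₂
  even-brick f () | true | true | true

  module Tour (u : Fin m) (j : Fin 3) (rest : List TV) (cyc : IsCycle T (zv u j ∷ rest)) (visits : ∀ t → t ∈ zv u j ∷ rest) where

    z : TV
    z = zv u j

    l : List TV
    l = rest ++ z ∷ []

    l-linked : Linked TAdj (z ∷ l)
    l-linked = proj₂ (proj₂ cyc)

    perm : z ∷ rest ↭ l
    perm = ++-comm (z ∷ []) rest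

    l-unique : Unique l
    l-unique = Unique-↭ perm (proj₁ (proj₂ cyc))

    l-all : ∀ t → t ∈ l
    l-all t = ∈-resp-↭ perm (visits t)

    ends-outside : ∀ b t l → EndsOutside b t (l ++ z ∷ [])
    ends-outside b t [] ()
    ends-outside b t (t′ ∷ l) = ends-outside b t′ l

    segments : ∀ b → ∃[ ss ] Parse b z l ss
    segments b = parse b z l (λ ()) l-linked (ends-outside b z rest)

    spanning : ∀ {b ss} → Parse b z l ss → Spanning (bodies ss)
    spanning {b} p = bodies-unique p l-unique
      , (λ i e → toWitnessFalse (proj₁ (bodies-sound p i)) e)
      , (λ {a} ne → bodies-complete {q = fromWitnessFalse ne} p (l-all _))

    -- Since l ends with z, a first segment returning to z would be all of l.
    good : ∀ {b ss} → Parse b z l ss → All Good ss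
    good p = go p refl refl
      where
      go : ∀ {b t k ss} → Parse b t k ss → t ≡ z → k ≡ l → All Good ss
      go (done _) _ _ = []
      go (skip _ p) _ q = starts≢ends p (subst Unique (sym q) l-unique)
      go {b} (seg {σ} {ε} {k} B s p) e q =
        (s , σ≢ε) ∷ starts≢ends p (unique-++ʳ (map (put b) B) (subst Unique (sym q) l-unique))
        where
        -- A tour consisting of `z` and a single segment would miss the other z-vertices of the
        -- triple.
        other-z : ∀ (j : Fin 3) → ∃[ j′ ] j′ ≢ j
        other-z zero = i₁ , λ ()
        other-z (suc _) = i₀ , λ ()
        j′ : Fin 3
        j′ = proj₁ (other-z j)
        σ≢ε : σ ≢ ε
        σ≢ε refl with subst (zv u j′ ∈_) (trans (sym q) (cong (λ t → map (put b) B ++ t ∷ k) e)) (l-all (zv u j′))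
        ... | i = absurd (subst (λ k → zv u j′ ∈ map (put b) B ++ z ∷ k)
                    (unique-last rest (map (put b) B) (trans (sym q) (cong (λ t → map (put b) B ++ t ∷ k) e)) l-unique) i)
          where
          absurd : zv u j′ ∈ map (put b) B ++ z ∷ [] → ⊥
          absurd i with ∈-++⁻ (map (put b) B) i
          ... | inj₂ (here r) = proj₂ (other-z j) (cong zv-index r)
            where
            zv-index : TV → Fin 3
            zv-index (zv _ j) = j
            zv-index (brk _ i _ _) = i
          ... | inj₁ k with ∈-map⁻ (put b) k
          ...   | _ , _ , ()

    full-segment : ∃[ i ] ∃[ s ] (s ∈ proj₁ (segments (u , i)) × Full s)
    full-segment with even-brick (λ i → wz-parity (u , i) z l)
           (trans (triple-parity u z rest z l-linked) (Bool.xor-same (zᵇ u z)))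
    ... | i , e with segments (u , i) in eq
    ...   | ss , p with classify ss (good p) (spanning p)
    ...     | inj₁ (s , k , f) = i , s , subst (λ q → s ∈ proj₁ q) (sym eq) k , f
    ...     | inj₂ (odd , _) = ⊥-elim (true≢false odd (trans (sym (parse-parity p)) e))

    full-links : ∀ b {τ₁ τ₂} → XYPair τ₁ τ₂ →
      outer-nb b τ₁ ≡ put (σ M b) (term τ₂) × outer-nb b τ₂ ≡ put (σ M b) (term τ₁)
    full-links b (inj₁ (refl , refl)) = refl , refl
    full-links b (inj₂ (refl , refl)) = refl , refl

    full-terms : ∀ {τ₁ τ₂ τ} → XYPair τ₁ τ₂ → XY τ → τ ≡ τ₁ ⊎ τ ≡ τ₂
    full-terms (inj₁ (refl , refl)) isX = inj₁ refl
    full-terms (inj₁ (refl , refl)) isY = inj₂ refl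
    full-terms (inj₂ (refl , refl)) isX = inj₂ refl
    full-terms (inj₂ (refl , refl)) isY = inj₁ refl

    full-XY : ∀ {τ₁ τ₂} → XYPair τ₁ τ₂ → XY τ₁
    full-XY (inj₁ (refl , refl)) = isX
    full-XY (inj₂ (refl , refl)) = isY

    full-≢ : ∀ {τ₁ τ₂} → XYPair τ₁ τ₂ → τ₁ ≢ τ₂
    full-≢ (inj₁ (refl , refl)) ()
    full-≢ (inj₂ (refl , refl)) ()

    full-same : ∀ {τ₁ τ₂} → XYPair τ₁ τ₂ → ∀ {τ₃} → XYPair τ₁ τ₃ → τ₂ ≡ τ₃
    full-same (inj₁ (refl , refl)) (inj₁ (_ , refl)) = refl
    full-same (inj₁ (refl , refl)) (inj₂ (() , _))
    full-same (inj₂ (refl , refl)) (inj₂ (_ , refl)) = refl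
    full-same (inj₂ (refl , refl)) (inj₁ (() , _))

    -- The partner brick is also traversed between its x- and y-vertex; the two
    -- traversals follow each other cyclically, so each would come before the other.
    no-full : ∀ b {ss s} → Parse b z l ss → s ∈ ss → Full s → ⊥
    no-full b {ss} {τ₁ , ps , τ₂} p i f = go (classify ss′ (good p′) (spanning p′))
      where
      b′ : Dart m
      b′ = σ M b
      ss′ = proj₁ (segments b′)
      p′ : Parse b′ z l ss′
      p′ = proj₂ (segments b′)
      out : ∀ {α} → ¬ In b′ (put b α)
      out (_ , e) = noFix M b (sym (in-dart e))
      e₁ : outer-nb b τ₁ ≡ put b′ (term τ₂)
      e₁ = proj₁ (full-links b f)
      e₂ : outer-nb b τ₂ ≡ put b′ (term τ₁)
      e₂ = proj₂ (full-links b f)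
      -- The links cross: the tour comes to `τ₁` of `b` from `τ₂` of `b′`, where a segment of `b′`
      -- ends, and goes from `τ₂` of `b` to `τ₁` of `b′`, where another passage begins.
      g₁ : ∃[ g ] (g ∈ ss′ × tv (final g) ≡ tv τ₂)
      g₁ = found-final p′ (out {term τ₁}) (subst (λ t → Consec t (put b (term τ₁)) (z ∷ l)) e₁ (enters p i))
      g₂ : ∃[ g ] (g ∈ ss′ × tv (start g) ≡ tv τ₁)
      g₂ = found-start p′ (out {term τ₂}) (subst (λ t → Consec (put b (term τ₂)) t (z ∷ l)) e₂ (exits p i))
      τ₂-final : final (proj₁ g₁) ≡ τ₂
      τ₂-final = tv-inj (proj₂ (proj₂ g₁))
      τ₁-start : start (proj₁ g₂) ≡ τ₁
      τ₁-start = tv-inj (proj₂ (proj₂ g₂))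
      before : Before (put b′ (term τ₂)) (put b′ (term τ₁)) l
      before with subst₂ (λ s t → Before s t (z ∷ l)) e₁ e₂ (passes p i)
      ... | there h = h
      go : (∃[ s ] (s ∈ ss′ × Full s)) ⊎ Odd ss′ → ⊥
      go (inj₂ (_ , τ , t , τ∉)) with full-terms f t
      ... | inj₁ refl = τ∉ (subst (_∈ ends ss′) τ₁-start (start∈ends (proj₁ (proj₂ g₂))))
      ... | inj₂ refl = τ∉ (subst (_∈ ends ss′) τ₂-final (final∈ends (proj₁ (proj₂ g₁))))
      go (inj₁ ((τ₃ , ps′ , τ₄) , i′ , f′)) with full-terms f (full-XY f′)
      -- Run in this direction, the partner's segment would start at `τ₂`, which is already the end
      -- of a segment.
      ... | inj₂ refl = start≢final (ends-unique (good p′) (proj₁ (spanning p′))) i′ (proj₁ (proj₂ g₁)) (sym τ₂-final)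
      ... | inj₁ refl with full-same f f′
      ...   | refl = before-asym l-unique before (traverses p′ i′ (full-≢ f′))

  non-hamiltonian : ¬ Hamiltonian T
  non-hamiltonian (c ∷ cs , cyc , all) = conclude (rotate {T} cyc (all (zv (triple-of c) i₀)))
    where
    conclude : ∃[ rest ] (IsCycle T (zv (triple-of c) i₀ ∷ rest) × (∀ {a} → a ∈ c ∷ cs → a ∈ zv (triple-of c) i₀ ∷ rest)) → ⊥
    conclude (rest , cyc′ , visit) = finish full-segment
      where
      open Tour (triple-of c) i₀ rest cyc′ (λ t → visit (all t))
      finish : ∃[ i ] ∃[ s ] (s ∈ proj₁ (segments (triple-of c , i)) × Full s) → ⊥
      finish (i , s , k , f) = no-full (triple-of c , i) (proj₂ (segments (triple-of c , i))) k f

theorem2 : ∀ {n : ℕ} (E : Fin n → Fin n → Set)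
    → (∀ a b → E a b → E b a)
    → (∀ a → ¬ E a a)
    → Cubic (mkGraph (Fin n) E)
    → CyclicallyConnected 4 (mkGraph (Fin n) E)
    → ¬ Hamiltonian (mkGraph (Fin n) E)
    → (v : Fin n) (w : Fin 3 → Fin n)
    → (∀ i j → w i ≡ w j → i ≡ j)
    → (∀ j → E v (w j))
    → (x y : Fin n) → E x y
    → Dist≥ (mkGraph (Fin n) E) 3 v x
    → Dist≥ (mkGraph (Fin n) E) 3 v y
    → (∀ (C : EdgeList (mkGraph (Fin n) E))
    → length C ≡ 4
    → DistinctEdges (mkGraph (Fin n) E) C
    → IsCyclicEdgeCut (mkGraph (Fin n) E) C
    → (∀ {a b} → (a , b) ∈ C → a ≢ v × b ≢ v × a ≢ x × b ≢ x)
    × ¬ Connected (deleteEdges (mkGraph (Fin n) E) C) v x)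
    → ∀ {m : ℕ} (M : CubicMultigraph m)
    → ThreeEdgeConnected M
    → CyclicallyConnected 5 (Construction.T E v w x y M)
    × ¬ Hamiltonian (Construction.T E v w x y M)
theorem2 E sym-E irrefl-E cubic cyc4 nonham v w w-inj vw x y xy far-x far-y cuts4 M conn =
  Cuts.cyclically-5-connected E sym-E irrefl-E cubic v w w-inj vw x y xy far-x far-y cyc4 cuts4 M conn
  , HamiltonianT.non-hamiltonian E sym-E irrefl-E cubic nonham v w w-inj vw x y xy far-x far-y M
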